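{- No infinite finitely generated group is elementarily equivalent (in the first-order language of groups) to an ultraproduct of a family of finite alternating groups.
   Context: Two groups are elementarily equivalent if they satisfy the same first-order sentences in the language of groups. -}

module Defs where

open import Algebra.Bundles using (Group)
open import Data.Fin.Base using (Fin)
open import Data.Fin.Permutation as Perm
  using (Permutation′; _∘ₚ_; flip; transpose; _⟨$⟩ʳ_; inverseˡ; inverseʳ)
open import Data.Fin.Permutation.Transposition.List using (TranspositionList; eval)
open import Data.List.Base using ([]; _∷_; _++_; length)
open import Data.List.Properties using (length-++)
open import Data.List.Relation.Unary.All using (All; []; _∷_)
open import Data.List.Relation.Unary.All.Properties using (++⁺)
open import Data.Nat.Base using (ℕ; suc)
open import Data.Nat.Divisibility using (_∣_; _∣0; ∣m∣n⇒∣m+n)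
open import Data.Nat.Properties using (+-comm)
open import Data.Product.Base using (Σ; ∃; _×_; _,_)
open import Data.Sum.Base using (_⊎_)
open import Data.Empty.Polymorphic using (⊥)
open import Data.Vec.Base using (Vec; []; _∷_; lookup)
open import Function.Base using (_∘_)
open import Function.Bundles using (_⇔_; Inverse)
open import Level using (Level; Lift; _⊔_; 0ℓ) renaming (suc to lsuc)
open import Relation.Binary.PropositionalEquality
  using (_≡_; _≢_; refl; sym; trans; cong; subst; setoid)
open import Relation.Nullary using (¬_)
open import Relation.Unary using (Pred; Decidable; _⊆_; _∩_; ∁)
open import Relation.Unary.Polymorphic using (U; ∅)

private
  variable
    a b c i p u ℓ ℓ₁ ℓ₂ : Level
    k n : ℕ

-- `Term n` and `Formula n` have their free variables among `Fin n`
-- (de Bruijn: a quantifier binds variable zero).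

infixl 7 _·_
infix  8 _⁻¹ᵗ
data Term (n : ℕ) : Set where
  var : Fin n → Term n
  one : Term n
  _·_ : Term n → Term n → Term n
  _⁻¹ᵗ : Term n → Term n

infix  6 _≐_
infixr 5 _∧_
infixr 4 _∨_
infixr 3 _⇒_
data Formula (n : ℕ) : Set where
  _≐_ : Term n → Term n → Formula n
  ⊥ᶠ  : Formula n
  _∧_ _∨_ _⇒_ : Formula n → Formula n → Formula n
  ∀ᶠ ∃ᶠ : Formula (suc n) → Formula n

Sentence : Set
Sentence = Formula 0

module _ (G : Group c ℓ) where
  private module G = Group G

  ⟦_⟧ : Term n → Vec G.Carrier n → G.Carrier
  ⟦ var x ⟧ ρ = lookup ρ x
  ⟦ one ⟧   ρ = G.ε
  ⟦ s · t ⟧ ρ = ⟦ s ⟧ ρ G.∙ ⟦ t ⟧ ρ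
  ⟦ t ⁻¹ᵗ ⟧ ρ = ⟦ t ⟧ ρ G.⁻¹

  Sat : Formula n → Vec G.Carrier n → Set (c ⊔ ℓ)
  Sat (s ≐ t) ρ = Lift c (⟦ s ⟧ ρ G.≈ ⟦ t ⟧ ρ)
  Sat ⊥ᶠ      ρ = ⊥
  Sat (φ ∧ ψ) ρ = Sat φ ρ × Sat ψ ρ
  Sat (φ ∨ ψ) ρ = Sat φ ρ ⊎ Sat ψ ρ
  Sat (φ ⇒ ψ) ρ = Sat φ ρ → Sat ψ ρ
  Sat (∀ᶠ φ)  ρ = ∀ x → Sat φ (x ∷ ρ)
  Sat (∃ᶠ φ)  ρ = ∃ λ x → Sat φ (x ∷ ρ)

infix 4 _⊨_
_⊨_ : Group c ℓ → Sentence → Set (c ⊔ ℓ)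
G ⊨ φ = Sat G φ []

ElementarilyEquivalent : Group a ℓ₁ → Group b ℓ₂ → Set (a ⊔ ℓ₁ ⊔ b ⊔ ℓ₂)
ElementarilyEquivalent G H = ∀ (φ : Sentence) → G ⊨ φ ⇔ H ⊨ φ

module _ (G : Group c ℓ) where
  open Group G

  data ⟨_⟩ (g : Fin k → Carrier) : Pred Carrier (c ⊔ ℓ) where
    gen  : ∀ j → ⟨ g ⟩ (g j)
    unit : ⟨ g ⟩ ε
    mul  : ∀ {x y} → ⟨ g ⟩ x → ⟨ g ⟩ y → ⟨ g ⟩ (x ∙ y)
    inv  : ∀ {x} → ⟨ g ⟩ x → ⟨ g ⟩ (x ⁻¹)
    resp : ∀ {x y} → x ≈ y → ⟨ g ⟩ x → ⟨ g ⟩ y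

FinitelyGenerated : Group c ℓ → Set (c ⊔ ℓ)
FinitelyGenerated G =
  Σ ℕ λ k → Σ (Fin k → Group.Carrier G) λ g → ∀ x → ⟨_⟩ G g x

Finite : Group c ℓ → Set (c ⊔ ℓ)
Finite G = Σ ℕ λ n → Inverse (Group.setoid G) (setoid (Fin n))

Infinite : Group c ℓ → Set (c ⊔ ℓ)
Infinite G = ¬ Finite G

-- `Large P` says that the subset P of I belongs to the ultrafilter.
-- The dichotomy is asked of decidable subsets only. Classically these
-- are all the subsets, so this is the usual notion; constructively it is
-- the weaker requirement, and the one that principal ultrafilters meet.
record Ultrafilter (I : Set i) (p u : Level) : Set (i ⊔ lsuc (p ⊔ u)) where
  field
    Large    : Pred (Pred I p) u
    whole    : Large U
    proper   : ¬ Large ∅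
    superset : ∀ {P Q} → P ⊆ Q → Large P → Large Q
    meet     : ∀ {P Q} → Large P → Large Q → Large (P ∩ Q)
    ultra    : ∀ P → Decidable P → Large P ⊎ Large (∁ P)

-- The quotient is taken by making "equal on a large set" the equality of
-- the product.
Ultraproduct : {I : Set i} → Ultrafilter I ℓ u → (I → Group c ℓ) →
               Group (i ⊔ c) u
Ultraproduct {I = I} 𝓤 G = record
  { Carrier = ∀ j → G.Carrier j
  ; _≈_     = λ f g → Large λ j → G._≈_ j (f j) (g j)
  ; _∙_     = λ f g j → G._∙_ j (f j) (g j)
  ; ε       = λ j → G.ε j
  ; _⁻¹     = λ f j → G._⁻¹ j (f j)
  ; isGroup = record
    { isMonoid = record
      { isSemigroup = record
        { isMagma = record
          { isEquivalence = record
            { refl  = everywhere λ j → G.refl j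
            ; sym   = superset λ {j} → G.sym j
            ; trans = λ P Q → superset (λ {j} (x , y) → G.trans j x y) (meet P Q)
            }
          ; ∙-cong = λ P Q → superset (λ {j} (x , y) → G.∙-cong j x y) (meet P Q)
          }
        ; assoc = λ f g h → everywhere λ j → G.assoc j (f j) (g j) (h j)
        }
      ; identity = (λ f → everywhere λ j → G.identityˡ j (f j))
                 , (λ f → everywhere λ j → G.identityʳ j (f j))
      }
    ; inverse = (λ f → everywhere λ j → G.inverseˡ j (f j))
              , (λ f → everywhere λ j → G.inverseʳ j (f j))
    ; ⁻¹-cong = superset λ {j} → G.⁻¹-cong j
    }
  }
  where
  open Ultrafilter 𝓤
  module G (j : I) = Group (G j)

  everywhere : ∀ {P} → (∀ j → P j) → Large P
  everywhere all = superset (λ {j} _ → all j) whole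

-- A permutation is even if it is a product of an even number of
-- transpositions. The condition i ≢ j is needed because the library's
-- `transpose i i` is the identity.
Even : Permutation′ n → Set
Even {n} π = Σ (TranspositionList n) λ ts →
  All (λ (i , j) → i ≢ j) ts × 2 ∣ length ts × eval ts Perm.≈ π

private
  eval-++ : (xs ys : TranspositionList n) →
            eval (xs ++ ys) Perm.≈ (eval xs ∘ₚ eval ys)
  eval-++ []             ys x = refl
  eval-++ ((i , j) ∷ xs) ys x = eval-++ xs ys (transpose i j ⟨$⟩ʳ x)

  invert : TranspositionList n → TranspositionList n
  invert []             = []
  invert ((i , j) ∷ ts) = invert ts ++ (j , i) ∷ []

  eval-invert : (ts : TranspositionList n) →
                eval (invert ts) Perm.≈ flip (eval ts)
  eval-invert []             x = refl
  eval-invert ((i , j) ∷ ts) x =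
    trans (eval-++ (invert ts) ((j , i) ∷ []) x)
          (cong (transpose j i ⟨$⟩ʳ_) (eval-invert ts x))

  length-invert : (ts : TranspositionList n) → length (invert ts) ≡ length ts
  length-invert []             = refl
  length-invert ((i , j) ∷ ts) =
    trans (length-++ (invert ts))
          (trans (+-comm (length (invert ts)) 1) (cong suc (length-invert ts)))

  invert-≢ : {ts : TranspositionList n} →
             All (λ (i , j) → i ≢ j) ts → All (λ (i , j) → i ≢ j) (invert ts)
  invert-≢ []       = []
  invert-≢ (d ∷ ds) = ++⁺ (invert-≢ ds) ((d ∘ sym) ∷ [])

  flip-cong : {π σ : Permutation′ n} → π Perm.≈ σ → flip π Perm.≈ flip σ
  flip-cong {π = π} {σ} eq x =
    trans (cong (flip π ⟨$⟩ʳ_) (sym (inverseʳ σ)))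
          (trans (cong (flip π ⟨$⟩ʳ_) (sym (eq (flip σ ⟨$⟩ʳ x)))) (inverseˡ π))

even-id : Even {n} Perm.id
even-id = [] , [] , (2 ∣0) , λ _ → refl

even-∘ : {π σ : Permutation′ n} → Even π → Even σ → Even (π ∘ₚ σ)
even-∘ {σ = σ} (xs , dx , ex , px) (ys , dy , ey , py) =
    xs ++ ys
  , ++⁺ dx dy
  , subst (2 ∣_) (sym (length-++ xs)) (∣m∣n⇒∣m+n ex ey)
  , λ x → trans (eval-++ xs ys x)
                (trans (py (eval xs ⟨$⟩ʳ x)) (cong (σ ⟨$⟩ʳ_) (px x)))

even-flip : {π : Permutation′ n} → Even π → Even (flip π)
even-flip {π = π} (ts , d , e , p) =
    invert ts
  , invert-≢ d
  , subst (2 ∣_) (sym (length-invert ts)) e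
  , λ x → trans (eval-invert ts x) (flip-cong {π = eval ts} {π} p x)

Alternating : ℕ → Group 0ℓ 0ℓ
Alternating n = record
  { Carrier = Σ (Permutation′ n) Even
  ; _≈_     = λ (π , _) (σ , _) → π Perm.≈ σ
  ; _∙_     = λ (π , e) (σ , d) → π ∘ₚ σ , even-∘ {π = π} {σ} e d
  ; ε       = Perm.id , even-id
  ; _⁻¹     = λ (π , e) → flip π , even-flip {π = π} e
  ; isGroup = record
    { isMonoid = record
      { isSemigroup = record
        { isMagma = record
          { isEquivalence = record
            { refl  = λ _ → refl
            ; sym   = λ eq x → sym (eq x)
            ; trans = λ eq eq′ x → trans (eq x) (eq′ x)
            }
          ; ∙-cong = λ {(π , _)} {(π′ , _)} {(σ , _)} eq eq′ x →
              trans (cong (σ ⟨$⟩ʳ_) (eq x)) (eq′ (π′ ⟨$⟩ʳ x))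
          }
        ; assoc = λ _ _ _ _ → refl
        }
      ; identity = (λ _ _ → refl) , (λ _ _ → refl)
      }
    ; inverse = (λ (π , _) _ → inverseʳ π) , (λ (π , _) _ → inverseˡ π)
    ; ⁻¹-cong = λ {(π , _)} {(σ , _)} → flip-cong {π = π} {σ}
    }
  }

{-# OPTIONS --safe #-}

-- In a large alternating group the stabiliser H of a point is definable from
-- seven parameters, so points become cosets of H, and an element d codes the set
-- of its fixed points.  Given g₁, …, g_k, the balls around two base points in the
-- Schreier graph of g₁, …, g_k on the points form a chain of sets whose
-- surroundings can be described by one further permutation c: order the points
-- by distance and let c send each point to its predecessor.  The description is a
-- first-order sentence about every g₁, …, g_k, and by Łoś's theorem it passes to
-- any G elementarily equivalent to the ultraproduct.  If the g_j generate G, the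
-- point farthest from the base points is reached from them by a genuine finite
-- word, hence it lies in a ball of genuinely finite index.  That ball is finite
-- and is everything up to one more step, so H has finite index in G, and G, acting
-- faithfully on the cosets of H, is finite.
--
-- Constructively, Łoś's theorem holds because satisfaction in a finite group is
-- decidable, and that G is finite is only obtained up to double negation.
module Submission where

open import Defs
open import Algebra.Bundles using (Group)
open import Data.Nat.Base using (ℕ)
open import Level using (Level; 0ℓ)
open import Relation.Nullary using (¬_)

import Algebra.Properties.Group as GroupProperties
open import Data.Empty using (⊥; ⊥-elim)
open import Data.Fin.Base as Fin using (Fin; zero; suc; toℕ; combine; funToFin; finToFun; _↑ˡ_; _↑ʳ_)
open import Data.Fin.Permutation as Perm using (Permutation′; transpose; _⟨$⟩ʳ_; _⟨$⟩ˡ_; inverseˡ; inverseʳ)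
open import Data.Fin.Permutation.Transposition.List using (TranspositionList; eval)
open import Data.Fin.Properties using (_≟_; any?; all?; ¬∀⟶∃¬; pigeonhole; finToFun-funToFin; suc-injective; combine-injective; ↑ˡ-injective; <⇒≢)
open import Data.List.Base as List using (List; []; _∷_; _++_; map; concatMap; allFin; filter; length; lookup; cartesianProduct; cartesianProductWith)
open import Data.List.Membership.Propositional using (_∈_; find; lose)
open import Data.List.Membership.Propositional.Properties using (∈-allFin; ∈-lookup; ∈-filter⁺; ∈-filter⁻; ∈-map⁺; ∈-cartesianProduct⁺; ∈-cartesianProductWith⁺)
open import Data.List.Relation.Binary.Permutation.Propositional using (↭-sym; ↭⇒↭ₛ)
open import Data.List.Relation.Binary.Permutation.Propositional.Properties using (∈-resp-↭)
open import Data.List.Relation.Binary.Permutation.Setoid.Properties using (Unique-resp-↭)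
open import Data.List.Relation.Unary.All as All using (All; []; _∷_)
open import Data.List.Relation.Unary.All.Properties using (¬Any⇒All¬)
open import Data.List.Relation.Unary.AllPairs as AllPairs using (AllPairs; []; _∷_)
open import Data.List.Relation.Unary.Any as Any using (Any; here; there)
open import Data.List.Relation.Unary.Any.Properties using (++⁺ˡ; ++⁺ʳ; map⁺; concatMap⁺; lookup-index)
open import Data.List.Relation.Unary.Linked.Properties using (Linked⇒AllPairs)
open import Data.List.Relation.Unary.Unique.Propositional using (Unique)
open import Data.List.Relation.Unary.Unique.Propositional.Properties using (allFin⁺) renaming (filter⁺ to Unique-filter⁺)
open import Data.List.Sort using (sort; sort-↭; sort-↗)
open import Data.Nat.Base as ℕ using (zero; suc; _+_; _^_; _≤_; _<_; z≤n; s≤s)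
open import Data.Nat.Divisibility using (_∣_; divides; _∣0; ∣m∣n⇒∣m+n; ∣m+n∣m⇒∣n; ∣-refl)
open import Data.Nat.Properties as ℕₚ using (≤-trans; ≤-refl; <⇒≱; ≰⇒>; n<1+n; ≤⇒≤′; m+[n∸m]≡n; ≤-decTotalOrder)
open import Data.Product.Base using (Σ; ∃; ∃₂; _×_; _,_; proj₁; proj₂)
open import Data.Sum.Base as Sum using (_⊎_; inj₁; inj₂; [_,_]′)
open import Data.Vec.Base as Vec using (Vec; []; _∷_)
open import Data.Vec.Properties using (lookup∘tabulate; lookup-++ˡ; lookup-++ʳ)
open import Function.Base using (_∘_; id)
open import Function.Bundles using (Equivalence; _⇔_; mk⇔)
open import Level using (Lift; lift; lower; _⊔_)
open import Relation.Binary.Core using (Rel)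
import Relation.Binary.Construct.On as On
open import Relation.Binary.Definitions using () renaming (Decidable to Decidable₂)
open import Relation.Binary.PropositionalEquality as ≡ using (_≡_; _≢_; refl; sym; trans; cong; cong₂; subst)
import Relation.Binary.Reasoning.Setoid as SetoidReasoning
open import Relation.Nullary using (Dec; yes; no; contradiction)
open import Relation.Nullary.Decidable as Dec using (¬¬-excluded-middle; decidable-stable; _×-dec_; _⊎-dec_; _→-dec_; ¬?)
open import Relation.Unary using (Pred; Decidable; _⊆_)

open Equivalence

private
  variable
    ℓ ℓ₁ ℓ₂ : Level
    k m n : ℕ

-- Satisfaction and finiteness

⋁ : (Fin m → Formula n) → Formula n
⋁ {zero}  φ = ⊥ᶠ
⋁ {suc m} φ = φ zero ∨ ⋁ (φ ∘ suc)

⋀ : (Fin m → Formula n) → Formula n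
⋀ {zero}  φ = ⊥ᶠ ⇒ ⊥ᶠ
⋀ {suc m} φ = φ zero ∧ ⋀ (φ ∘ suc)

close∀ : ∀ k → Formula k → Sentence
close∀ zero    φ = φ
close∀ (suc k) φ = close∀ k (∀ᶠ φ)

close∃ : ∀ k → Formula k → Sentence
close∃ zero    φ = φ
close∃ (suc k) φ = close∃ k (∃ᶠ φ)

module _ (G : Group ℓ₁ ℓ₂) where
  open Group G using (Carrier; _≈_)
    renaming (refl to ≈-refl; sym to ≈-sym; trans to ≈-trans; ∙-cong to ∙≈; ⁻¹-cong to ⁻¹≈)

  ⟦⟧-cong : (t : Term n) {ρ σ : Vec Carrier n} →
            (∀ i → Vec.lookup ρ i ≈ Vec.lookup σ i) → ⟦_⟧ G t ρ ≈ ⟦_⟧ G t σ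
  ⟦⟧-cong (var x) eq = eq x
  ⟦⟧-cong one     eq = ≈-refl
  ⟦⟧-cong (s · t) eq = ∙≈ (⟦⟧-cong s eq) (⟦⟧-cong t eq)
  ⟦⟧-cong (t ⁻¹ᵗ) eq = ⁻¹≈ (⟦⟧-cong t eq)

  private
    extend : {x y : Carrier} {ρ σ : Vec Carrier n} → x ≈ y →
             (∀ i → Vec.lookup ρ i ≈ Vec.lookup σ i) →
             ∀ i → Vec.lookup (x ∷ ρ) i ≈ Vec.lookup (y ∷ σ) i
    extend x≈y eq zero    = x≈y
    extend x≈y eq (suc i) = eq i

  Sat-cong : (φ : Formula n) {ρ σ : Vec Carrier n} →
             (∀ i → Vec.lookup ρ i ≈ Vec.lookup σ i) → Sat G φ ρ → Sat G φ σ
  Sat-cong (s ≐ t) eq (lift e) =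
    lift (≈-trans (≈-sym (⟦⟧-cong s eq)) (≈-trans e (⟦⟧-cong t eq)))
  Sat-cong (φ ∧ ψ) eq (x , y)  = Sat-cong φ eq x , Sat-cong ψ eq y
  Sat-cong (φ ∨ ψ) eq (inj₁ x) = inj₁ (Sat-cong φ eq x)
  Sat-cong (φ ∨ ψ) eq (inj₂ y) = inj₂ (Sat-cong ψ eq y)
  Sat-cong (φ ⇒ ψ) eq f        = Sat-cong ψ eq ∘ f ∘ Sat-cong φ (≈-sym ∘ eq)
  Sat-cong (∀ᶠ φ)  eq f x      = Sat-cong φ (extend ≈-refl eq) (f x)
  Sat-cong (∃ᶠ φ)  eq (x , s)  = x , Sat-cong φ (extend ≈-refl eq) s

  Sat-head : (φ : Formula (suc n)) {ρ : Vec Carrier n} {x y : Carrier} →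
             x ≈ y → Sat G φ (x ∷ ρ) → Sat G φ (y ∷ ρ)
  Sat-head φ x≈y = Sat-cong φ (extend x≈y (λ _ → ≈-refl))

  Sat-⋁ : (φ : Fin m → Formula n) {ρ : Vec Carrier n} →
          Sat G (⋁ φ) ρ ⇔ ∃ λ j → Sat G (φ j) ρ
  Sat-⋁ φ = mk⇔ (to′ φ) (λ (j , s) → from′ φ j s)
    where
    to′ : ∀ {m} (φ : Fin m → Formula n) {ρ} → Sat G (⋁ φ) ρ → ∃ λ j → Sat G (φ j) ρ
    to′ {m = suc m} φ (inj₁ s) = zero , s
    to′ {m = suc m} φ (inj₂ s) = let (j , s′) = to′ (φ ∘ suc) s in suc j , s′
    from′ : ∀ {m} (φ : Fin m → Formula n) {ρ} j → Sat G (φ j) ρ → Sat G (⋁ φ) ρ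
    from′ φ zero    s = inj₁ s
    from′ φ (suc j) s = inj₂ (from′ (φ ∘ suc) j s)

  Sat-⋀ : (φ : Fin m → Formula n) {ρ : Vec Carrier n} →
          Sat G (⋀ φ) ρ ⇔ (∀ j → Sat G (φ j) ρ)
  Sat-⋀ φ = mk⇔ (to′ φ) (from′ φ)
    where
    to′ : ∀ {m} (φ : Fin m → Formula n) {ρ} → Sat G (⋀ φ) ρ → ∀ j → Sat G (φ j) ρ
    to′ φ (s , _) zero    = s
    to′ φ (_ , s) (suc j) = to′ (φ ∘ suc) s j
    from′ : ∀ {m} (φ : Fin m → Formula n) {ρ} → (∀ j → Sat G (φ j) ρ) → Sat G (⋀ φ) ρ
    from′ {m = zero}  φ s = λ ()
    from′ {m = suc m} φ s = s zero , from′ (φ ∘ suc) (s ∘ suc)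

  Sat-close∀ : ∀ k (φ : Formula k) → G ⊨ close∀ k φ ⇔ (∀ ρ → Sat G φ ρ)
  Sat-close∀ zero    φ = mk⇔ (λ { s [] → s }) (λ s → s [])
  Sat-close∀ (suc k) φ = mk⇔
    (λ { s (x ∷ ρ) → to (Sat-close∀ k (∀ᶠ φ)) s ρ x })
    (λ s → from (Sat-close∀ k (∀ᶠ φ)) (λ ρ x → s (x ∷ ρ)))

  Sat-close∃ : ∀ k (φ : Formula k) → G ⊨ close∃ k φ ⇔ (∃ λ ρ → Sat G φ ρ)
  Sat-close∃ zero    φ = mk⇔ (λ s → [] , s) (λ { ([] , s) → s })
  Sat-close∃ (suc k) φ = mk⇔
    (λ s → let (ρ , x , s′) = to (Sat-close∃ k (∃ᶠ φ)) s in x ∷ ρ , s′)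
    (λ { (x ∷ ρ , s) → from (Sat-close∃ k (∃ᶠ φ)) (ρ , x , s) })

  -- Repetitions up to `_≈_` are allowed, so an enumeration, unlike `Finite`, does not by itself
  -- decide equality.
  Enumerated : Set (ℓ₁ ⊔ ℓ₂)
  Enumerated = Σ (List Carrier) λ xs → ∀ x → Any (x ≈_) xs

  Sat? : Enumerated → Decidable₂ _≈_ → (φ : Formula n) (ρ : Vec Carrier n) → Dec (Sat G φ ρ)
  Sat? e _≈?_ (s ≐ t) ρ = Dec.map′ lift lower (⟦_⟧ G s ρ ≈? ⟦_⟧ G t ρ)
  Sat? e _≈?_ ⊥ᶠ      ρ = no λ ()
  Sat? e _≈?_ (φ ∧ ψ) ρ = Sat? e _≈?_ φ ρ ×-dec Sat? e _≈?_ ψ ρ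
  Sat? e _≈?_ (φ ∨ ψ) ρ = Sat? e _≈?_ φ ρ ⊎-dec Sat? e _≈?_ ψ ρ
  Sat? e _≈?_ (φ ⇒ ψ) ρ = Sat? e _≈?_ φ ρ →-dec Sat? e _≈?_ ψ ρ
  Sat? e@(xs , cover) _≈?_ (∀ᶠ φ) ρ = Dec.map′
    (λ all x → let (y , y∈xs , x≈y) = find (cover x) in
      Sat-head φ (≈-sym x≈y) (All.lookup all y∈xs))
    (λ s → All.tabulate (λ {x} _ → s x))
    (All.all? (λ x → Sat? e _≈?_ φ (x ∷ ρ)) xs)
  Sat? e@(xs , cover) _≈?_ (∃ᶠ φ) ρ = Dec.map′
    Any.satisfied
    (λ (x , s) → Any.map (λ x≈y → Sat-head φ x≈y s) (cover x))
    (Any.any? (λ x → Sat? e _≈?_ φ (x ∷ ρ)) xs)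

  -- Whether a value of `f` is attained may be undecidable, but only finitely many instances of
  -- excluded middle are at stake, and under a double negation these are available.
  ¬¬finite : ∀ {K} (f : Carrier → Fin K) → (∀ {x y} → f x ≡ f y → x ≈ y) → ¬ ¬ Finite G
  ¬¬finite {K} f reflects infinite = represent (allFin K) λ (xs , irr , cover) →
    infinite (finite xs irr λ x → cover x (∈-allFin (f x)))
    where
    Represented : List (Fin K) → Set (ℓ₁ ⊔ ℓ₂)
    Represented ks = Σ (List Carrier) λ xs →
      AllPairs (λ x y → ¬ (x ≈ y)) xs × (∀ x → f x ∈ ks → Any (x ≈_) xs)

    represent : ∀ ks → ¬ ¬ Represented ks
    represent []       ret = ret ([] , [] , λ _ ())
    represent (k ∷ ks) ret = represent ks λ (xs , irr , cover) →
      ¬¬-excluded-middle λ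
        { (no none) → ret (xs , irr , λ
            { x (here e)  → contradiction (x , e) none
            ; x (there i) → cover x i })
        -- `f` is not assumed to respect `_≈_`, so a new value may come from an element that is
        -- already listed up to `_≈_`.
        ; (yes (y , fy≡k)) → ¬¬-excluded-middle λ
            { (yes old) → ret (xs , irr , λ
                { x (here e)  → Any.map (≈-trans (reflects (trans e (sym fy≡k)))) old
                ; x (there i) → cover x i })
            ; (no new) → ret (y ∷ xs , ¬Any⇒All¬ xs new ∷ irr , λ
                { x (here e)  → here (reflects (trans e (sym fy≡k)))
                ; x (there i) → there (cover x i) })
            }
        }

    lookup-inj : ∀ {xs} → AllPairs (λ x y → ¬ (x ≈ y)) xs →
                 ∀ i j → lookup xs i ≈ lookup xs j → i ≡ j
    lookup-inj (_ ∷ _)   zero    zero    _ = refl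
    lookup-inj (new ∷ _) zero    (suc j) e = contradiction e (All.lookup new (∈-lookup j))
    lookup-inj (new ∷ _) (suc i) zero    e = contradiction (≈-sym e) (All.lookup new (∈-lookup i))
    lookup-inj (_ ∷ irr) (suc i) (suc j) e = cong suc (lookup-inj irr i j e)

    finite : ∀ xs → AllPairs (λ x y → ¬ (x ≈ y)) xs → (∀ x → Any (x ≈_) xs) → Finite G
    finite xs irr cover = length xs , record
      { to = index
      ; from = lookup xs
      ; to-cong = λ {x} {y} x≈y → lookup-inj irr _ _
          (≈-trans (≈-sym (at x)) (≈-trans x≈y (at y)))
      ; from-cong = λ { refl → ≈-refl }
      ; inverse = (λ {i} {x} e → lookup-inj irr _ _ (≈-trans (≈-sym (at x)) e))
                , (λ { {x} refl → ≈-sym (at x) })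
      }
      where
      index : Carrier → Fin (length xs)
      index x = Any.index (cover x)
      at : ∀ x → x ≈ lookup xs (index x)
      at x = lookup-index (cover x)

-- Łoś's theorem for finite groups

module _ {I : Set ℓ₁} (𝓤 : Ultrafilter I 0ℓ ℓ₂) (G : I → Group 0ℓ 0ℓ)
         (enum : ∀ j → Enumerated (G j)) (_≈?_ : ∀ {j} → Decidable₂ (Group._≈_ (G j))) where
  open Ultrafilter 𝓤
  private
    P = Ultraproduct 𝓤 G
    module G j = Group (G j)

    at : Vec (Group.Carrier P) n → ∀ j → Vec (G.Carrier j) n
    at ρ j = Vec.map (λ f → f j) ρ

    sat? : ∀ (φ : Formula n) {j} (ρ : Vec (G.Carrier j) n) → Dec (Sat (G j) φ ρ)
    sat? φ {j} = Sat? (G j) (enum j) _≈?_ φ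

    ⟦⟧-at : (t : Term n) (ρ : Vec (Group.Carrier P) n) (j : I) → ⟦_⟧ P t ρ j ≡ ⟦_⟧ (G j) t (at ρ j)
    ⟦⟧-at (var zero)    (f ∷ ρ) j = refl
    ⟦⟧-at (var (suc x)) (f ∷ ρ) j = ⟦⟧-at (var x) ρ j
    ⟦⟧-at one           ρ j = refl
    ⟦⟧-at (s · t)       ρ j = cong₂ (G._∙_ j) (⟦⟧-at s ρ j) (⟦⟧-at t ρ j)
    ⟦⟧-at (t ⁻¹ᵗ)       ρ j = cong (G._⁻¹ j) (⟦⟧-at t ρ j)

    -- Deciding the existential formula at each index makes the choice function explicit; `ε` is the
    -- default where there is no witness.
    witness : (φ : Formula (suc n)) (ρ : ∀ j → Vec (G.Carrier j) n) →
              Σ (∀ j → G.Carrier j) λ f → ∀ j → Sat (G j) (∃ᶠ φ) (ρ j) → Sat (G j) φ (f j ∷ ρ j)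
    witness φ ρ = (λ j → proj₁ (pick j)) , (λ j → proj₂ (pick j))
      where
      pick : ∀ j → Σ (G.Carrier j) λ x → Sat (G j) (∃ᶠ φ) (ρ j) → Sat (G j) φ (x ∷ ρ j)
      pick j with sat? (∃ᶠ φ) (ρ j)
      ... | yes (x , s) = x , λ _ → s
      ... | no  none    = G.ε j , λ some → contradiction some none

  -- The two directions need a joint induction, because the premise of an implication is transferred
  -- the opposite way.
  Łoś⇒ : (φ : Formula n) (ρ : Vec (Group.Carrier P) n) →
         Sat P φ ρ → Large λ j → Sat (G j) φ (at ρ j)
  Łoś⇐ : (φ : Formula n) (ρ : Vec (Group.Carrier P) n) →
         Large (λ j → Sat (G j) φ (at ρ j)) → Sat P φ ρ

  Łoś⇒ (s ≐ t) ρ (lift e) = superset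
    (λ {j} e → lift (G.trans j (G.reflexive j (sym (⟦⟧-at s ρ j)))
                               (G.trans j e (G.reflexive j (⟦⟧-at t ρ j)))))
    e
  Łoś⇒ (φ ∧ ψ) ρ (x , y)  = meet (Łoś⇒ φ ρ x) (Łoś⇒ ψ ρ y)
  Łoś⇒ (φ ∨ ψ) ρ (inj₁ x) = superset inj₁ (Łoś⇒ φ ρ x)
  Łoś⇒ (φ ∨ ψ) ρ (inj₂ y) = superset inj₂ (Łoś⇒ ψ ρ y)
  Łoś⇒ (φ ⇒ ψ) ρ f with ultra _ (λ j → sat? φ (at ρ j))
  ... | inj₁ often = superset (λ s _ → s) (Łoś⇒ ψ ρ (f (Łoś⇐ φ ρ often)))
  ... | inj₂ rarely = superset (λ ¬s s → contradiction s ¬s) rarely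
  -- `f` takes a counterexample at every index that has one, so the truth of `φ` at `f` excludes
  -- counterexamples on a large set.
  Łoś⇒ (∀ᶠ φ) ρ s with witness (φ ⇒ ⊥ᶠ) (at ρ)
  ... | f , bad = superset
    (λ {j} ok x → decidable-stable (sat? φ (x ∷ at ρ j)) λ ¬s →
      lower (bad j (x , λ s → contradiction s ¬s) ok))
    (Łoś⇒ φ (f ∷ ρ) (s f))
  Łoś⇒ (∃ᶠ φ) ρ (f , s) = superset (λ {j} s → f j , s) (Łoś⇒ φ (f ∷ ρ) s)

  Łoś⇐ (s ≐ t) ρ e = lift (superset
    (λ {j} (lift e) → G.trans j (G.reflexive j (⟦⟧-at s ρ j))
                               (G.trans j e (G.reflexive j (sym (⟦⟧-at t ρ j)))))
    e)
  Łoś⇐ ⊥ᶠ      ρ s = contradiction (superset (λ ()) s) proper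
  Łoś⇐ (φ ∧ ψ) ρ s = Łoś⇐ φ ρ (superset proj₁ s) , Łoś⇐ ψ ρ (superset proj₂ s)
  Łoś⇐ (φ ∨ ψ) ρ s with ultra _ (λ j → sat? φ (at ρ j))
  ... | inj₁ often  = inj₁ (Łoś⇐ φ ρ often)
  ... | inj₂ rarely = inj₂ (Łoś⇐ ψ ρ (superset
    (λ { (inj₁ x , ¬x) → contradiction x ¬x ; (inj₂ y , _) → y }) (meet s rarely)))
  Łoś⇐ (φ ⇒ ψ) ρ s x = Łoś⇐ ψ ρ (superset (λ (f , x) → f x) (meet s (Łoś⇒ φ ρ x)))
  Łoś⇐ (∀ᶠ φ) ρ s f = Łoś⇐ φ (f ∷ ρ) (superset (λ {j} s → s (f j)) s)
  Łoś⇐ (∃ᶠ φ) ρ s with witness φ (at ρ)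
  ... | f , good = f , Łoś⇐ φ (f ∷ ρ) (superset (λ {j} → good j) s)

-- Alternating groups are finite

chain-mono : {A : Set} (b : ℕ → Pred A ℓ) → (∀ i → b i ⊆ b (suc i)) → ∀ {i j} → i ≤ j → b i ⊆ b j
chain-mono b step i≤j = go (≤⇒≤′ i≤j)
  where
  go : ∀ {i j} → i ℕ.≤′ j → b i ⊆ b j
  go (ℕ.≤′-reflexive refl) = id
  go (ℕ.≤′-step i≤j) = step _ ∘ go i≤j

abstract
  -- Otherwise each of the first k + 1 steps adds a point. By the pigeonhole principle two steps add
  -- the same one, which by the later step is already present.
  chain-stabilises : (b : ℕ → Pred (Fin k) ℓ) → (∀ i → Decidable (b i)) →
                     (∀ i → b i ⊆ b (suc i)) → ∃ λ m → b (suc m) ⊆ b m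
  chain-stabilises {k} b b? step
    with any? {n = suc k} (λ m → all? λ x → b? (suc (toℕ m)) x →-dec b? (toℕ m) x)
  ... | yes (m , stable) = toℕ m , stable _
  ... | no  growing = ⊥-elim (clash (pigeonhole (n<1+n k) new))
    where
    grow : (m : Fin (suc k)) → ∃ λ x → ¬ (b (suc (toℕ m)) x → b (toℕ m) x)
    grow m = ¬∀⟶∃¬ k _ (λ x → b? (suc (toℕ m)) x →-dec b? (toℕ m) x)
      λ stable → growing (m , stable)
    new : Fin (suc k) → Fin k
    new = proj₁ ∘ grow
    isNew : ∀ m → b (suc (toℕ m)) (new m)
    isNew m = decidable-stable (b? _ _) λ ¬b → proj₂ (grow m) λ s → contradiction s ¬b
    isNotOld : ∀ m → ¬ b (toℕ m) (new m)
    isNotOld m old = proj₂ (grow m) λ _ → old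
    clash : ¬ ∃₂ λ i j → i Fin.< j × new i ≡ new j
    clash (i , j , i<j , same) = isNotOld j (subst (b _) same (chain-mono b step i<j (isNew i)))

module A n = Group (Alternating n)

_≟ᴬ_ : Decidable₂ (A._≈_ n)
(π , _) ≟ᴬ (σ , _) = all? λ x → (π ⟨$⟩ʳ x) ≟ (σ ⟨$⟩ʳ x)

code : A.Carrier n → Fin (n ^ n)
code (π , _) = funToFin (π ⟨$⟩ʳ_)

code-injective : {x y : A.Carrier n} → code x ≡ code y → A._≈_ n x y
code-injective {n} {π , _} {σ , _} eq i =
  trans (sym (finToFun-funToFin (π ⟨$⟩ʳ_) i))
        (trans (cong (λ c → finToFun c i) eq) (finToFun-funToFin (σ ⟨$⟩ʳ_) i))

swaps : (a b c d : Fin n) → a ≢ b → c ≢ d → A.Carrier n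
swaps a b c d a≢b c≢d = eval ts , ts , a≢b ∷ c≢d ∷ [] , ∣-refl , λ _ → refl
  where ts = (a , b) ∷ (c , d) ∷ []

-- The junk value ε is taken when one of the transpositions is trivial.
twoSwaps : (Fin n × Fin n) × (Fin n × Fin n) → A.Carrier n
twoSwaps {n} ((i , j) , (k , l)) with i ≟ j | k ≟ l
... | no i≢j | no k≢l = swaps i j k l i≢j k≢l
... | _ | _ = A.ε n

twoSwaps-eval : ∀ {i j k l : Fin n} → i ≢ j → k ≢ l → ∀ x →
                proj₁ (twoSwaps ((i , j) , (k , l))) ⟨$⟩ʳ x ≡ eval ((i , j) ∷ (k , l) ∷ []) ⟨$⟩ʳ x
twoSwaps-eval {i = i} {j} {k} {l} i≢j k≢l x with i ≟ j | k ≟ l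
... | yes i≡j | _       = contradiction i≡j i≢j
... | no _    | yes k≡l = contradiction k≡l k≢l
... | no _    | no _    = refl

-- The sets of products of at most m pairs of transpositions increase inside a
-- finite set, so they stabilise, at a set closed under multiplication by pairs.
Alternating-enumerated : ∀ n → Enumerated (Alternating n)
Alternating-enumerated n = words (proj₁ stable) , λ (π , ts , distinct , even , eq) →
  Any.map (λ e x → trans (sym (eq x)) (e x)) (reach ts distinct even)
  where
  open A n using (_∙_; ε)

  pairs : List (A.Carrier n)
  pairs = map twoSwaps (cartesianProduct both both)
    where both = cartesianProduct (allFin n) (allFin n)

  words : ℕ → List (A.Carrier n)
  words zero    = ε ∷ []
  words (suc m) = words m ++ cartesianProductWith _∙_ pairs (words m)

  Coded : ℕ → Pred (Fin (n ^ n)) 0ℓ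
  Coded m c = Any (λ x → c ≡ code x) (words m)

  stable = chain-stabilises Coded (λ m c → Any.any? (λ x → c ≟ code x) (words m)) (λ _ → ++⁺ˡ)
  M = proj₁ stable

  Reached : Permutation′ n → Set
  Reached π = Any (λ x → π Perm.≈ proj₁ x) (words M)

  decode : ∀ {m} {x : A.Carrier n} → Coded m (code x) → Any (λ y → proj₁ x Perm.≈ proj₁ y) (words m)
  decode {x = x} = Any.map λ {y} → code-injective {x = x} {y}

  reach : ∀ ts → All (λ (i , j) → i ≢ j) ts → 2 ∣ length ts → Reached (eval ts)
  reach [] _ _ = decode {M} {ε} (chain-mono Coded (λ _ → ++⁺ˡ) {j = M} z≤n (here refl))
  reach (_ ∷ []) _ (divides zero ())
  reach (_ ∷ []) _ (divides (suc _) ())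
  reach ((i , j) ∷ (k , l) ∷ ts) (i≢j ∷ k≢l ∷ distinct) even
    with find (reach ts distinct (∣m+n∣m⇒∣n even ∣-refl))
  ... | x , x∈ , ts≈x = Any.map
    (λ e p → trans (trans (ts≈x _) (cong (proj₁ x ⟨$⟩ʳ_) (sym (twoSwaps-eval i≢j k≢l p)))) (e p))
    (decode {M} {y ∙ x} (proj₂ stable (++⁺ʳ (words M)
      (Any.map (cong code) (∈-cartesianProductWith⁺ _∙_ y∈ x∈)))))
    where
    y = twoSwaps ((i , j) , (k , l))
    y∈ : y ∈ pairs
    y∈ = ∈-map⁺ twoSwaps (∈-cartesianProduct⁺
      (∈-cartesianProduct⁺ (∈-allFin i) (∈-allFin j))
      (∈-cartesianProduct⁺ (∈-allFin k) (∈-allFin l)))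

-- The sentence

-- In the intended models, x stands for the image of a point 0 under x, and the
-- seven parameters are permutations s₀, …, s₄, t₀, t₁ (module Star below).
-- H is the stabiliser of 0, Q x says that the point x is one of the base points
-- 0 and 0 s₀, M d x that it is a base point or fixed by d, and N is the
-- neighbourhood of a set of points under the generators.  The index e counts the
-- variables bound so far, which come before the parameters and the generators.
module _ (k : ℕ) where
  private
    Ctx : ℕ → ℕ
    Ctx e = e + (7 + k)

  param : ∀ e → Fin 7 → Term (Ctx e)
  param e i = var (e ↑ʳ (i ↑ˡ k))

  generator : ∀ e → Fin k → Term (Ctx e)
  generator e j = var (e ↑ʳ (7 ↑ʳ j))

  noncommutingᶠ : ∀ e → Term (Ctx e) → Fin 2 → Fin 5 → Formula (Ctx e)
  noncommutingᶠ e z i j = (u · s ≐ s · u) ⇒ ⊥ᶠ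
    where
    u = z ⁻¹ᵗ · param e (5 ↑ʳ i) · z
    s = param e (j ↑ˡ 2)

  -- The 3-cycles s₀, ..., s₄ share only the point 0, so a permutation moving just four points fails
  -- to commute with all of them only if it moves 0. Both conjugates of t₀ and t₁ by z move 0 only
  -- if z fixes 0.
  Hᶠ Qᶠ : ∀ e → Term (Ctx e) → Formula (Ctx e)
  Hᶠ e z = ⋀ λ i → ⋀ λ j → noncommutingᶠ e z i j
  Qᶠ e x = Hᶠ e x ∨ Hᶠ e (x · param e zero ⁻¹ᵗ)

  -- Base points belong to the set whatever `d` does to them. This leaves room to correct the parity
  -- of `d` by the transposition of the two base points.
  Mᶠ : ∀ e → Term (Ctx e) → Term (Ctx e) → Formula (Ctx e)
  Mᶠ e d x = Qᶠ e x ∨ Hᶠ e (x · d · x ⁻¹ᵗ)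

  Nᶠ : ∀ e → (Term (Ctx e) → Formula (Ctx e)) → Term (Ctx e) → Formula (Ctx e)
  Nᶠ e φ x = φ x ∨ ⋁ λ j → φ (x · generator e j ⁻¹ᵗ) ∨ φ (x · generator e j)

  -- With `c` the predecessor map, these are the initial segments of the order by distance. `c` and
  -- `d` are variables, so that `suc` weakens them under the quantifier.
  Θᶠ : ∀ e (c d : Fin (Ctx e)) → Formula (Ctx e)
  Θᶠ e c d = ∀ᶠ (M x ⇒ Qᶠ (suc e) x ∨ M (x · var (suc c)))
    where
    x = var zero
    M = Mᶠ (suc e) (var (suc d))

  private
    v0 : Fin (suc n)
    v0 = zero
    v1 : Fin (2 + n)
    v1 = suc zero
    v2 : Fin (3 + n)
    v2 = suc (suc zero)
    v3 : Fin (4 + n)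
    v3 = suc (suc (suc zero))

  -- `stuckᶠ`: some coded set is a proper union of components of the graph.
  -- `layeredᶠ`: among the sets closed under c (variable c of Θᶠ) are the base
  -- points, each such set B has a successor between N B and N (N B), and only
  -- those with N B everything contain ω.
  closedᶠ faithfulᶠ stuckᶠ layeredᶠ : Formula (7 + k)
  closedᶠ = ∀ᶠ (∀ᶠ (Hᶠ 2 (var v1) ⇒ Hᶠ 2 (var v0) ⇒ Hᶠ 2 (var v1 · var v0)))
  -- Equal action on the coset of y is expressed by a common representative y′ of the image, which
  -- closure of H under products can supply.
  faithfulᶠ = ∀ᶠ (∀ᶠ (
    ∀ᶠ (∃ᶠ (Hᶠ 4 (var v1 · var v3 · var v0 ⁻¹ᵗ) ∧ Hᶠ 4 (var v1 · var v2 · var v0 ⁻¹ᵗ)))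
    ⇒ var v1 ≐ var v0))
  stuckᶠ = ∃ᶠ (∃ᶠ (Mᶠ 2 (var v1) (var v0) ⇒ ⊥ᶠ)
    ∧ ∀ᶠ (Nᶠ 2 (Mᶠ 2 (var v1)) (var v0) ⇒ Mᶠ 2 (var v1) (var v0)))
  layeredᶠ = ∃ᶠ (∃ᶠ (
      ∃ᶠ (Θᶠ 3 v2 v0 ∧ ∀ᶠ (Mᶠ 4 (var v1) (var v0) ⇒ Qᶠ 4 (var v0)))
    ∧ ∀ᶠ (Θᶠ 3 v2 v0 ⇒ ∃ᶠ (Θᶠ 4 v3 v0
        ∧ ∀ᶠ (Nᶠ 5 (Mᶠ 5 (var v2)) (var v0) ⇒ Mᶠ 5 (var v1) (var v0))
        ∧ ∀ᶠ (Mᶠ 5 (var v1) (var v0) ⇒ Nᶠ 5 (Nᶠ 5 (Mᶠ 5 (var v2))) (var v0))))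
    ∧ ∀ᶠ (Θᶠ 3 v2 v0 ⇒ Mᶠ 3 (var v0) (var v1) ⇒ ∀ᶠ (Nᶠ 4 (Mᶠ 4 (var v1)) (var v0)))))

  χ : Formula (7 + k)
  χ = Hᶠ 0 one ∧ closedᶠ ∧ faithfulᶠ ∧ (stuckᶠ ∨ layeredᶠ)

  basedᶠ : Formula k
  basedᶠ = ∃ᶠ (∃ᶠ (∃ᶠ (∃ᶠ (∃ᶠ (∃ᶠ (∃ᶠ χ))))))

  layering : Sentence
  layering = close∀ k basedᶠ

module Sem (G : Group ℓ₁ ℓ₂) {k} (ρ : Vec (Group.Carrier G) (7 + k)) where
  open Group G using (Carrier; _≈_; _∙_; ε; _⁻¹)

  H Q : Carrier → Set (ℓ₁ ⊔ ℓ₂)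
  H z = Sat G (Hᶠ k 1 (var zero)) (z ∷ ρ)
  Q x = H x ⊎ H (x ∙ Vec.lookup ρ zero ⁻¹)

  H⇔ : ∀ z → H z ⇔ (∀ i j → let u = z ⁻¹ ∙ Vec.lookup ρ ((5 ↑ʳ i) ↑ˡ k) ∙ z
                                s = Vec.lookup ρ ((j ↑ˡ 2) ↑ˡ k)
                            in ¬ (u ∙ s ≈ s ∙ u))
  H⇔ z = mk⇔
    (λ h i j e → lower (to (Sat-⋀ G (φ i) {z ∷ ρ}) (to (Sat-⋀ G (λ i → ⋀ (φ i)) {z ∷ ρ}) h i) j (lift e)))
    (λ h → from (Sat-⋀ G (λ i → ⋀ (φ i)) {z ∷ ρ}) λ i → from (Sat-⋀ G (φ i) {z ∷ ρ}) λ j (lift e) →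
      contradiction e (h i j))
    where φ = noncommutingᶠ k 1 (var zero)

  M : Carrier → Carrier → Set (ℓ₁ ⊔ ℓ₂)
  M d x = Q x ⊎ H (x ∙ d ∙ x ⁻¹)

  g : Fin k → Carrier
  g j = Vec.lookup ρ (7 ↑ʳ j)

  N : (Carrier → Set (ℓ₁ ⊔ ℓ₂)) → Carrier → Set (ℓ₁ ⊔ ℓ₂)
  N P x = P x ⊎ ∃ λ j → P (x ∙ g j ⁻¹) ⊎ P (x ∙ g j)

  Θ : Carrier → Carrier → Set (ℓ₁ ⊔ ℓ₂)
  Θ c d = ∀ x → M d x → Q x ⊎ M d (x ∙ c)

  Closed Faithful Stuck Layered : Set (ℓ₁ ⊔ ℓ₂)
  Closed = ∀ x y → H x → H y → H (x ∙ y)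
  Faithful = ∀ x x′ → (∀ y → ∃ λ y′ → H (y ∙ x ∙ y′ ⁻¹) × H (y ∙ x′ ∙ y′ ⁻¹)) → Lift ℓ₁ (x ≈ x′)
  Stuck = ∃ λ d → (∃ λ x → M d x → Lift (ℓ₁ ⊔ ℓ₂) ⊥) × (∀ x → N (M d) x → M d x)
  Layered = ∃ λ c → ∃ λ ω →
      (∃ λ d → Θ c d × (∀ x → M d x → Q x))
    × (∀ d → Θ c d → ∃ λ d′ → Θ c d′ × (∀ x → N (M d) x → M d′ x) × (∀ x → M d′ x → N (N (M d)) x))
    × (∀ d → Θ c d → M d ω → ∀ x → N (M d) x)

  N-map : ∀ {P P′ : Carrier → Set (ℓ₁ ⊔ ℓ₂)} → (∀ {x} → P x → P′ x) → ∀ {x} → N P x → N P′ x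
  N-map f (inj₁ p)            = inj₁ (f p)
  N-map f (inj₂ (j , inj₁ p)) = inj₂ (j , inj₁ (f p))
  N-map f (inj₂ (j , inj₂ p)) = inj₂ (j , inj₂ (f p))

  private
    Sat-N : ∀ {e} (τ : Vec Carrier e) (φ : Term (e + (7 + k)) → Formula (e + (7 + k)))
            {P : Carrier → Set (ℓ₁ ⊔ ℓ₂)} →
            (∀ t → Sat G (φ t) (τ Vec.++ ρ) ⇔ P (⟦_⟧ G t (τ Vec.++ ρ))) →
            ∀ t → Sat G (Nᶠ k e φ t) (τ Vec.++ ρ) ⇔ N P (⟦_⟧ G t (τ Vec.++ ρ))
    Sat-N {e} τ φ {P} φ⇔P t = mk⇔ to′ from′
      where
      gen≡ : ∀ j → ⟦_⟧ G (generator k e j) (τ Vec.++ ρ) ≡ g j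
      gen≡ j = lookup-++ʳ τ ρ (7 ↑ʳ j)
      x = ⟦_⟧ G t (τ Vec.++ ρ)
      to′ : Sat G (Nᶠ k e φ t) (τ Vec.++ ρ) → N P x
      to′ (inj₁ s) = inj₁ (to (φ⇔P t) s)
      to′ (inj₂ s) with to (Sat-⋁ G _) s
      ... | j , inj₁ s = inj₂ (j , inj₁ (subst (λ y → P (x ∙ y ⁻¹)) (gen≡ j) (to (φ⇔P _) s)))
      ... | j , inj₂ s = inj₂ (j , inj₂ (subst (λ y → P (x ∙ y)) (gen≡ j) (to (φ⇔P _) s)))
      from′ : N P x → Sat G (Nᶠ k e φ t) (τ Vec.++ ρ)
      from′ (inj₁ p) = inj₁ (from (φ⇔P t) p)
      from′ (inj₂ (j , inj₁ p)) = inj₂ (from (Sat-⋁ G _) (j , inj₁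
        (from (φ⇔P _) (subst (λ y → P (x ∙ y ⁻¹)) (sym (gen≡ j)) p))))
      from′ (inj₂ (j , inj₂ p)) = inj₂ (from (Sat-⋁ G _) (j , inj₂
        (from (φ⇔P _) (subst (λ y → P (x ∙ y)) (sym (gen≡ j)) p))))

  -- Most of the formula unfolds to its meaning by computation. The disjunction over k generators
  -- inside N does not reduce for variable k, so only the occurrences of N are translated.
  χ⇔ : Sat G (χ k) ρ ⇔ (H ε × Closed × Faithful × (Stuck ⊎ Layered))
  χ⇔ = mk⇔
    (λ (o , cl , fa , sl) → o , cl , fa , Sum.map
      (λ (d , x , f) → d , x , λ x → f x ∘ from (N₂ d x))
      (λ (c , ω , init , next , last) → c , ω , init
        , (λ d θ → let (d′ , θ′ , f , h) = next d θ in
            d′ , θ′ , (λ x → f x ∘ from (N₅ c ω d d′ x)) , (λ x → to (NN₅ c ω d d′ x) ∘ h x))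
        , (λ d θ m x → to (N₄ c ω d x) (last d θ m x)))
      sl)
    (λ (o , cl , fa , sl) → o , cl , fa , Sum.map
      (λ (d , x , f) → d , x , λ x → f x ∘ to (N₂ d x))
      (λ (c , ω , init , next , last) → c , ω , init
        , (λ d θ → let (d′ , θ′ , f , h) = next d θ in
            d′ , θ′ , (λ x → f x ∘ to (N₅ c ω d d′ x)) , (λ x → from (NN₅ c ω d d′ x) ∘ h x))
        , (λ d θ m x → from (N₄ c ω d x) (last d θ m x)))
      sl)
    where
    N₂ = λ d x → Sat-N (x ∷ d ∷ []) (Mᶠ k 2 (var (suc zero))) {M d} (λ _ → mk⇔ id id) (var zero)
    N₄ = λ c ω d x → Sat-N (x ∷ d ∷ ω ∷ c ∷ []) (Mᶠ k 4 (var (suc zero))) {M d} (λ _ → mk⇔ id id) (var zero)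
    N₅′ = λ c ω d d′ x → Sat-N (x ∷ d′ ∷ d ∷ ω ∷ c ∷ []) (Mᶠ k 5 (var (suc (suc zero)))) {M d} (λ _ → mk⇔ id id)
    N₅ = λ c ω d d′ x → N₅′ c ω d d′ x (var zero)
    NN₅ = λ c ω d d′ x → Sat-N (x ∷ d′ ∷ d ∷ ω ∷ c ∷ []) (Nᶠ k 5 (Mᶠ k 5 (var (suc (suc zero))))) {N (M d)} (N₅′ c ω d d′ x) (var zero)

Sat-based : (G : Group ℓ₁ ℓ₂) (k : ℕ) (γ : Vec (Group.Carrier G) k) →
            Sat G (basedᶠ k) γ ⇔ ∃ λ (σ : Vec (Group.Carrier G) 7) → Sat G (χ k) (σ Vec.++ γ)
Sat-based G k γ = mk⇔
  (λ (t₁ , t₀ , s₄ , s₃ , s₂ , s₁ , s₀ , sat) → s₀ ∷ s₁ ∷ s₂ ∷ s₃ ∷ s₄ ∷ t₀ ∷ t₁ ∷ [] , sat)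
  (λ { (s₀ ∷ s₁ ∷ s₂ ∷ s₃ ∷ s₄ ∷ t₀ ∷ t₁ ∷ [] , sat) → t₁ , t₀ , s₄ , s₃ , s₂ , s₁ , s₀ , sat })

-- Finitely generated groups satisfying the sentence

module Generated (G : Group ℓ₁ ℓ₂) {k} (ρ : Vec (Group.Carrier G) (7 + k))
                 (generated : ∀ x → ⟨_⟩ G (Sem.g G ρ) x) where
  open Group G hiding (refl; sym; trans)
  open Group G using () renaming (sym to ≈-sym; trans to ≈-trans)
  open Sem G ρ
  open SetoidReasoning setoid
  open GroupProperties G using (⁻¹-anti-homo-∙; ⁻¹-involutive; ε⁻¹≈ε; \\-leftDividesʳ; //-rightDividesˡ; //-rightDividesʳ)

  private
    H-cong : ∀ {x y} → x ≈ y → H x → H y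
    H-cong = Sat-head G (Hᶠ k 1 (var zero)) {ρ}

    Respects : (Carrier → Set (ℓ₁ ⊔ ℓ₂)) → Set (ℓ₁ ⊔ ℓ₂)
    Respects P = ∀ {x y} → x ≈ y → P x → P y

    M-resp : ∀ d → Respects (M d)
    M-resp d e (inj₁ (inj₁ h)) = inj₁ (inj₁ (H-cong e h))
    M-resp d e (inj₁ (inj₂ h)) = inj₁ (inj₂ (H-cong (∙-congʳ e) h))
    M-resp d e (inj₂ h)        = inj₂ (H-cong (∙-cong (∙-congʳ e) (⁻¹-cong e)) h)

  -- The induction shows for x and for x⁻¹ together that right multiplication preserves `P`, so that
  -- `inv` merely exchanges the two halves.
  everything : (P : Carrier → Set (ℓ₁ ⊔ ℓ₂)) → Respects P → P ε →
               (∀ x j → P x → P (x ∙ g j)) → (∀ x j → P x → P (x ∙ g j ⁻¹)) → ∀ x → P x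
  everything P P-resp pε right left x = P-resp (identityˡ x) (proj₁ (go (generated x)) ε pε)
    where
    go : ∀ {x} → ⟨_⟩ G g x → (∀ y → P y → P (y ∙ x)) × (∀ y → P y → P (y ∙ x ⁻¹))
    go (gen j) = (λ y → right y j) , (λ y → left y j)
    go unit    = (λ y → P-resp (≈-sym (identityʳ y)))
               , (λ y → P-resp (≈-sym (≈-trans (∙-congˡ ε⁻¹≈ε) (identityʳ y))))
    go (mul {a} {b} p q) =
        (λ y → P-resp (assoc y a b) ∘ proj₁ (go q) _ ∘ proj₁ (go p) y)
      , (λ y → P-resp (≈-trans (assoc y (b ⁻¹) (a ⁻¹)) (∙-congˡ (≈-sym (⁻¹-anti-homo-∙ a b))))
             ∘ proj₂ (go p) _ ∘ proj₂ (go q) y)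
    go (inv {a} p) = proj₂ (go p)
      , (λ y → P-resp (∙-congˡ (≈-sym (⁻¹-involutive a))) ∘ proj₁ (go p) y)
    go (resp e p) =
        (λ y → P-resp (∙-congˡ e) ∘ proj₁ (go p) y)
      , (λ y → P-resp (∙-congˡ (⁻¹-cong e)) ∘ proj₂ (go p) y)

  N-right : ∀ {P} → Respects P → ∀ x j → P x → N P (x ∙ g j)
  N-right P-resp x j p = inj₂ (j , inj₁ (P-resp (≈-sym (//-rightDividesʳ (g j) x)) p))

  N-left : ∀ {P} → Respects P → ∀ x j → P x → N P (x ∙ g j ⁻¹)
  N-left P-resp x j p = inj₂ (j , inj₂ (P-resp (≈-sym (//-rightDividesˡ (g j) x)) p))

  -- The Schreier graph of a generating family is connected, so a set containing the base coset and
  -- all its own neighbours is everything.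
  ¬Stuck : H ε → ¬ Stuck
  ¬Stuck hε (d , (x , ¬m) , closed) = lower (¬m (everything (M d) (M-resp d) (inj₁ (inj₁ hε))
    (λ y j m → closed _ (N-right {M d} (M-resp d) y j m))
    (λ y j m → closed _ (N-left {M d} (M-resp d) y j m)) x))

  -- `H (x ∙ y ⁻¹)` places x in the right coset H y, so `ys` lists representatives of cosets that
  -- cover `P`.
  Covered : List Carrier → (Carrier → Set (ℓ₁ ⊔ ℓ₂)) → Set (ℓ₁ ⊔ ℓ₂)
  Covered ys P = ∀ x → P x → Any (λ y → H (x ∙ y ⁻¹)) ys

  grow : List Carrier → List Carrier
  grow ys = ys ++ concatMap (λ j → map (_∙ g j) ys ++ map (_∙ g j ⁻¹) ys) (allFin k)

  grow-covers : ∀ {ys P} → Covered ys P → Covered (grow ys) (N P)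
  grow-covers cover x (inj₁ p) = ++⁺ˡ (cover x p)
  grow-covers {ys} cover x (inj₂ (j , inj₁ p)) = ++⁺ʳ ys (concatMap⁺ _ (lose (∈-allFin j)
    (++⁺ˡ (map⁺ (Any.map (λ {y} → H-cong (begin
      x ∙ g j ⁻¹ ∙ y ⁻¹   ≈⟨ assoc _ _ _ ⟩
      x ∙ (g j ⁻¹ ∙ y ⁻¹) ≈⟨ ∙-congˡ (⁻¹-anti-homo-∙ y (g j)) ⟨
      x ∙ (y ∙ g j) ⁻¹    ∎)) (cover _ p))))))
  grow-covers {ys} cover x (inj₂ (j , inj₂ p)) = ++⁺ʳ ys (concatMap⁺ _ (lose (∈-allFin j)
    (++⁺ʳ (map (_∙ g j) ys) (map⁺ (Any.map (λ {y} → H-cong (begin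
      x ∙ g j ∙ y ⁻¹          ≈⟨ assoc _ _ _ ⟩
      x ∙ (g j ∙ y ⁻¹)        ≈⟨ ∙-congˡ (∙-congʳ (⁻¹-involutive (g j))) ⟨
      x ∙ (g j ⁻¹ ⁻¹ ∙ y ⁻¹)  ≈⟨ ∙-congˡ (⁻¹-anti-homo-∙ y (g j ⁻¹)) ⟨
      x ∙ (y ∙ g j ⁻¹) ⁻¹     ∎)) (cover _ p))))))

  -- The i-th ball around the two base points is defined from elements of G only,
  -- but every element lies in one of standard index i, in particular ω does.
  layered⇒covered : H ε → Layered → ∃ λ ys → ∀ x → Any (λ y → H (x ∙ y ⁻¹)) ys
  layered⇒covered hε (c , ω , (d₀ , θ₀ , only) , next , last) =
    grow (proj₁ (covered r)) , λ x → grow-covers (proj₂ (covered r)) x (last _ (proj₂ (ball r)) ω∈ x)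
    where
    ball : ℕ → ∃ λ d → Θ c d
    ball zero    = d₀ , θ₀
    ball (suc i) = let (d , θ) = ball i ; (d′ , θ′ , _) = next d θ in d′ , θ′

    B : ℕ → Carrier → Set _
    B i = M (proj₁ (ball i))

    N⊆B : ∀ i {x} → N (B i) x → B (suc i) x
    N⊆B i = let (d , θ) = ball i ; (_ , _ , sub , _) = next d θ in sub _

    B⊆NN : ∀ i {x} → B (suc i) x → N (N (B i)) x
    B⊆NN i = let (d , θ) = ball i ; (_ , _ , _ , sup) = next d θ in sup _

    covered : ∀ i → ∃ λ ys → Covered ys (B i)
    covered zero = ε ∷ Vec.lookup ρ zero ∷ [] , λ x m → [ (λ h → here (H-cong
      (≈-sym (≈-trans (∙-congˡ ε⁻¹≈ε) (identityʳ x))) h)) , (λ h → there (here h)) ]′ (only x m)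
    covered (suc i) = let (ys , cover) = covered i in
      grow (grow ys) , λ x m → grow-covers (grow-covers cover) x (B⊆NN i m)

    inBall : ∀ x → ∃ λ i → B i x
    inBall = everything (λ x → ∃ λ i → B i x)
      (λ e (i , m) → i , M-resp _ e m)
      (zero , inj₁ (inj₁ hε))
      (λ x j (i , m) → suc i , N⊆B i (N-right {B i} (M-resp _) x j m))
      (λ x j (i , m) → suc i , N⊆B i (N-left {B i} (M-resp _) x j m))

    r = proj₁ (inBall ω)
    ω∈ = proj₂ (inBall ω)

  -- An element is determined by the self-map that it induces on the indices of the representatives.
  -- The choice of representatives may be arbitrary: by `move`, two elements with the same self-map
  -- send every coset to a common one.
  finiteOrbit⇒finite : Closed → Faithful → (∃ λ ys → ∀ x → Any (λ y → H (x ∙ y ⁻¹)) ys) → ¬ ¬ Finite G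
  finiteOrbit⇒finite closed faithful (ys , cover) =
    ¬¬finite G (λ x → funToFin (image x)) λ {x} {x′} e →
      lower (faithful x x′ (agree λ i →
        trans (sym (finToFun-funToFin (image x) i))
                (trans (cong (λ f → finToFun f i) e) (finToFun-funToFin (image x′) i))))
    where
    pt : Fin (length ys) → Carrier
    pt = List.lookup ys

    index : Carrier → Fin (length ys)
    index x = Any.index (cover x)

    at : ∀ x → H (x ∙ pt (index x) ⁻¹)
    at x = lookup-index (cover x)

    image : Carrier → Fin (length ys) → Fin (length ys)
    image x i = index (pt i ∙ x)

    move : ∀ x y → H (y ∙ x ∙ pt (image x (index y)) ⁻¹)
    move x y = H-cong (begin
        y ∙ b ⁻¹ ∙ (b ∙ x ∙ z ⁻¹)    ≈⟨ ∙-congˡ (assoc b x (z ⁻¹)) ⟩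
        y ∙ b ⁻¹ ∙ (b ∙ (x ∙ z ⁻¹))  ≈⟨ assoc y (b ⁻¹) _ ⟩
        y ∙ (b ⁻¹ ∙ (b ∙ (x ∙ z ⁻¹))) ≈⟨ ∙-congˡ (\\-leftDividesʳ b _) ⟩
        y ∙ (x ∙ z ⁻¹)               ≈⟨ assoc y x (z ⁻¹) ⟨
        y ∙ x ∙ z ⁻¹                 ∎)
      (closed _ _ (at y) (at (b ∙ x)))
      where
      b = pt (index y)
      z = pt (image x (index y))

    agree : ∀ {x x′} → (∀ i → image x i ≡ image x′ i) →
            ∀ y → ∃ λ y′ → H (y ∙ x ∙ y′ ⁻¹) × H (y ∙ x′ ∙ y′ ⁻¹)
    agree {x} {x′} eq y = pt (image x (index y)) , move x y ,
      subst (λ i → H (y ∙ x′ ∙ pt i ⁻¹)) (sym (eq (index y))) (move x′ y)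

  χ⇒finite : Sat G (χ k) ρ → ¬ ¬ Finite G
  χ⇒finite s = let (hε , closed , faithful , sl) = to χ⇔ s in
    [ (λ st → contradiction st (¬Stuck hε))
    , finiteOrbit⇒finite closed faithful ∘ layered⇒covered hε ]′ sl

-- Permutations from lists

transpose-left : (i j : Fin n) → transpose i j ⟨$⟩ʳ i ≡ j
transpose-left i j with i ≟ i
... | yes _  = refl
... | no i≢i = contradiction refl i≢i

transpose-right : (i j : Fin n) → transpose i j ⟨$⟩ʳ j ≡ i
transpose-right i j with j ≟ i
... | yes j≡i = j≡i
... | no _ with j ≟ j
...   | yes _  = refl
...   | no j≢j = contradiction refl j≢j

transpose-other : {i j k : Fin n} → k ≢ i → k ≢ j → transpose i j ⟨$⟩ʳ k ≡ k
transpose-other {i = i} {j} {k} k≢i k≢j with k ≟ i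
... | yes k≡i = contradiction k≡i k≢i
... | no _ with k ≟ j
...   | yes k≡j = contradiction k≡j k≢j
...   | no _    = refl

path : Fin n → List (Fin n) → TranspositionList n
path z []       = []
path z (y ∷ ys) = (z , y) ∷ path y ys

-- `cycle z ys` sends each entry of the list z ∷ ys to the preceding one,
-- and z to the last one.
cycle : Fin n → List (Fin n) → Permutation′ n
cycle z ys = eval (path z ys)

path-distinct : ∀ {z : Fin n} {ys} → Unique (z ∷ ys) → All (λ (i , j) → i ≢ j) (path z ys)
path-distinct {ys = []}     _               = []
path-distinct {ys = y ∷ ys} ((z≢y ∷ _) ∷ u) = z≢y ∷ path-distinct u

cycle-fixes : ∀ {z x : Fin n} {ys} → All (x ≢_) (z ∷ ys) → cycle z ys ⟨$⟩ʳ x ≡ x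
cycle-fixes {ys = []}     _                 = refl
cycle-fixes {ys = y ∷ ys} (x≢z ∷ x≢y ∷ new) =
  trans (cong (cycle y ys ⟨$⟩ʳ_) (transpose-other x≢z x≢y)) (cycle-fixes (x≢y ∷ new))

cycle-head : ∀ {z y : Fin n} {ys} → Unique (z ∷ y ∷ ys) → cycle z (y ∷ ys) ⟨$⟩ʳ y ≡ z
cycle-head {z = z} {y} {ys} (new ∷ _) =
  trans (cong (cycle y ys ⟨$⟩ʳ_) (transpose-right z y)) (cycle-fixes new)

cycle-tail : ∀ {z y x : Fin n} {ys} → Unique (z ∷ y ∷ ys) → x ∈ ys →
             cycle z (y ∷ ys) ⟨$⟩ʳ x ≡ cycle y ys ⟨$⟩ʳ x
cycle-tail {y = y} {ys = ys} ((_ ∷ z∉) ∷ (y∉ ∷ _)) x∈ =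
  cong (cycle y ys ⟨$⟩ʳ_) (transpose-other (All.lookup z∉ x∈ ∘ sym) (All.lookup y∉ x∈ ∘ sym))

-- With `_≢_` for `R` it shows that a cycle moves its entries, and with comparison of depths that a
-- predecessor is no farther from the base points.
cycle-related : ∀ {R : Rel (Fin n) ℓ} {z x ys} → Unique (z ∷ ys) → AllPairs R (z ∷ ys) →
                x ∈ ys → R (cycle z ys ⟨$⟩ʳ x) x
cycle-related {R = R} {x = x} u ((Rzy ∷ _) ∷ _) (here refl) =
  subst (λ w → R w x) (sym (cycle-head u)) Rzy
cycle-related {R = R} {x = x} u@(_ ∷ u′) (_ ∷ rs) (there x∈) =
  subst (λ w → R w x) (sym (cycle-tail u x∈)) (cycle-related u′ rs x∈)

AllPairs-compare : ∀ {X : Set} {R : Rel X ℓ} {xs x y} → AllPairs R xs → x ∈ xs → y ∈ xs →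
                   x ≡ y ⊎ R x y ⊎ R y x
AllPairs-compare (r ∷ rs) (here refl) (here refl) = inj₁ refl
AllPairs-compare (r ∷ rs) (here refl) (there y∈)  = inj₂ (inj₁ (All.lookup r y∈))
AllPairs-compare (r ∷ rs) (there x∈)  (here refl) = inj₂ (inj₂ (All.lookup r x∈))
AllPairs-compare (r ∷ rs) (there x∈)  (there y∈)  = AllPairs-compare rs x∈ y∈

-- Membership passes from each entry to its predecessor, hence down to the head. Where an entry is
-- exempt because its value is 0, the sorted order makes the predecessor's value 0 too, and `base`
-- applies.
closed⇒initial : (f : Fin n → ℕ) (B : Pred (Fin n) 0ℓ) → (∀ {x} → f x ≡ 0 → B x) →
                 ∀ {z ys} → Unique (z ∷ ys) → AllPairs (λ x y → f x ≤ f y) (z ∷ ys) →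
                 (∀ {x} → x ∈ ys → B x → f x ≡ 0 ⊎ B (cycle z ys ⟨$⟩ʳ x)) →
                 AllPairs (λ x y → B y → B x) (z ∷ ys)
closed⇒initial f B base {z} {[]} u sorted closed = [] ∷ []
closed⇒initial f B base {z} {y ∷ ys} u@(_ ∷ u′) ((fz≤fy ∷ _) ∷ sorted) closed = (first ∷ All.map (first ∘_) (AllPairs.head rest)) ∷ rest
  where
  rest = closed⇒initial f B base u′ sorted
    λ x∈ Bx → Sum.map₂ (subst B (cycle-tail u x∈)) (closed (there x∈) Bx)
  first : B y → B z
  first By = [ (λ fy≡0 → base (ℕₚ.n≤0⇒n≡0 (subst (f z ≤_) fy≡0 fz≤fy))) , subst B (cycle-head u) ]′
    (closed (here refl) By)

module _ (f : Fin (suc n) → ℕ) where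
  private
    O = On.decTotalOrder ≤-decTotalOrder f

  SortedEnumeration : Set
  SortedEnumeration =
    ∃₂ λ z ys → Unique (z ∷ ys) × AllPairs (λ x y → f x ≤ f y) (z ∷ ys) × (∀ x → x ∈ z ∷ ys)

  abstract
    sortedBy : SortedEnumeration
    sortedBy with sort O (allFin (suc n)) | sort-↭ O (allFin (suc n)) | sort-↗ O (allFin (suc n))
    ... | xs | xs↭ | sorted = go xs
       (Unique-resp-↭ (≡.setoid _) (↭⇒↭ₛ (↭-sym xs↭)) (allFin⁺ (suc n)))
       (Linked⇒AllPairs ≤-trans sorted) (λ x → ∈-resp-↭ (↭-sym xs↭) (∈-allFin x))
      where
      go : ∀ xs → Unique xs → AllPairs (λ x y → f x ≤ f y) xs → (∀ x → x ∈ xs) → SortedEnumeration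
      go []       _ _ total = contradiction (total zero) λ ()
      go (z ∷ ys) u s total = z , ys , u , s , total

2∣n⊎2∣1+n : ∀ n → 2 ∣ n ⊎ 2 ∣ suc n
2∣n⊎2∣1+n zero    = inj₁ (2 ∣0)
2∣n⊎2∣1+n (suc n) = [ (λ e → inj₂ (∣m∣n⇒∣m+n ∣-refl e)) , inj₁ ]′ (2∣n⊎2∣1+n n)

abstract
  -- An odd product is made even by putting the transposition of p and q in front, which affects no
  -- other point.
  evenAway : ∀ {p q : Fin n} → p ≢ q → (ts : TranspositionList n) → All (λ (i , j) → i ≢ j) ts →
             ∃ λ (d : A.Carrier n) → ∀ {x} → x ≢ p → x ≢ q → proj₁ d ⟨$⟩ʳ x ≡ eval ts ⟨$⟩ʳ x
  evenAway {p = p} {q} p≢q ts distinct with 2∣n⊎2∣1+n (length ts)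
  ... | inj₁ even = (eval ts , ts , distinct , even , λ _ → refl) , λ _ _ → refl
  ... | inj₂ even = (eval ((p , q) ∷ ts) , (p , q) ∷ ts , p≢q ∷ distinct , even , λ _ → refl) ,
    λ x≢p x≢q → cong (eval ts ⟨$⟩ʳ_) (transpose-other x≢p x≢q)

lastTrue : ∀ {P : Pred ℕ ℓ} → Decidable P → P 0 → ∀ m → ¬ P m → ∃ λ i → P i × ¬ P (suc i)
lastTrue P? p0 zero    ¬p = contradiction p0 ¬p
lastTrue P? p0 (suc m) ¬p with P? m
... | yes pm = m , pm , ¬p
... | no ¬pm = lastTrue P? p0 m ¬pm

-- Balls in a graph on Fin (suc n)

-- Products in Defs compose from left to right, so this is a right action.
infixl 5 _▹_
_▹_ : ∀ {n} → Fin n → A.Carrier n → Fin n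
p ▹ (π , _) = π ⟨$⟩ʳ p

module Points {n} (q : Fin (suc n)) (N : Pred (Fin (suc n)) 0ℓ → Pred (Fin (suc n)) 0ℓ) where

  -- This and the following definitions are `Q`, `M`, `Θ`, `Stuck` and `Layered` with points in
  -- place of group elements.
  Base : Pred (Fin (suc n)) 0ℓ
  Base p = p ≡ zero ⊎ p ≡ q

  In : A.Carrier (suc n) → Pred (Fin (suc n)) 0ℓ
  In d p = Base p ⊎ p ▹ d ≡ p

  Initial : (c d : A.Carrier (suc n)) → Set
  Initial c d = ∀ p → In d p → Base p ⊎ In d (p ▹ c)

  PtStuck PtLayered : Set
  PtStuck = ∃ λ d → (∃ λ p → ¬ In d p) × (∀ p → N (In d) p → In d p)
  PtLayered = ∃ λ c → ∃ λ w →
      (∃ λ d → Initial c d × (∀ p → In d p → Base p))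
    × (∀ d → Initial c d → ∃ λ d′ → Initial c d′
         × (∀ p → N (In d) p → In d′ p) × (∀ p → In d′ p → N (N (In d)) p))
    × (∀ d → Initial c d → In d w → ∀ p → N (In d) p)

  module _ (N? : ∀ {B} → Decidable B → Decidable (N B))
           (N-mono : ∀ {B C} → B ⊆ C → N B ⊆ N C) (N-infl : ∀ {B} → B ⊆ N B)
           (0≢q : zero ≢ q) (unbased : ∃ λ p → ¬ Base p) where
    private
      Base? : Decidable Base
      Base? p = (p ≟ zero) ⊎-dec (p ≟ q)

      In? : ∀ d → Decidable (In d)
      In? d p = Base? p ⊎-dec (p ▹ d ≟ p)

    -- `d` is a cycle through the complement of `B`, up to parity. The base point zero joins the
    -- cycle so that a complement consisting of a single point is moved as well.
    encode : (B : Pred (Fin (suc n)) 0ℓ) → Decidable B → Base ⊆ B → ∃ λ d → ∀ {p} → In d p ⇔ B p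
    encode B B? base⊆B = d , λ {p} → mk⇔ [ base⊆B , fixed⇒B p ]′ (B⇒In p)
      where
      ys = filter (¬? ∘ B?) (allFin (suc n))
      unique : Unique (zero ∷ ys)
      unique = All.tabulate (λ p∈ 0≡p → proj₂ (∈-filter⁻ (¬? ∘ B?) {xs = allFin (suc n)} p∈) (base⊆B (inj₁ (sym 0≡p))))
             ∷ Unique-filter⁺ (¬? ∘ B?) (allFin⁺ (suc n))
      away = evenAway 0≢q (path zero ys) (path-distinct unique)
      d = proj₁ away
      fixed⇒B : ∀ p → p ▹ d ≡ p → B p
      fixed⇒B p fix = decidable-stable (B? p) λ p∉B →
        cycle-related {R = _≢_} unique unique (∈-filter⁺ (¬? ∘ B?) (∈-allFin p) p∉B)
          (trans (sym (proj₂ away (p∉B ∘ base⊆B ∘ inj₁) (p∉B ∘ base⊆B ∘ inj₂))) fix)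
      B⇒In : ∀ p → B p → In d p
      B⇒In p p∈B with Base? p
      ... | yes base = inj₁ base
      ... | no ¬base = inj₂ (trans (proj₂ away (¬base ∘ inj₁) (¬base ∘ inj₂)) (cycle-fixes
        (¬base ∘ inj₁ ∷ All.tabulate λ {y} y∈ p≡y → proj₂ (∈-filter⁻ (¬? ∘ B?) {xs = allFin (suc n)} y∈) (subst B p≡y p∈B))))

    ball : ℕ → Pred (Fin (suc n)) 0ℓ
    ball zero    = Base
    ball (suc i) = N (ball i)

    private
      ball? : ∀ i → Decidable (ball i)
      ball? zero    = Base?
      ball? (suc i) = N? (ball? i)

      ball-mono : ∀ {i j} → i ≤ j → ball i ⊆ ball j
      ball-mono = chain-mono ball (λ _ → N-infl)

      stable = chain-stabilises ball ball? (λ _ → N-infl)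
      r = proj₁ stable

      encodeBall : ∀ i → ∃ λ d → ∀ {p} → In d p ⇔ ball i p
      encodeBall i = encode (ball i) (ball? i) (ball-mono {0} {i} z≤n)

    module Connected (total : ∀ p → ball r p) where

      abstract
        -- This is the distance to the base points. Since balls increase, any i at which p is
        -- outside `ball i` but inside the next ball determines it.
        depth : ∀ p → ∃ λ i → ∀ j → i ≤ j ⇔ ball j p
        depth p with Base? p
        ... | yes base = 0 , λ j → mk⇔ (λ _ → ball-mono {0} {j} z≤n base) (λ _ → z≤n)
        ... | no ¬base with lastTrue (λ i → ¬? (ball? i p)) ¬base r (λ ¬b → ¬b (total p))
        ...   | i , ¬b , ¬¬b = suc i , λ j → mk⇔
          (λ i<j → ball-mono {suc i} {j} i<j (decidable-stable (ball? (suc i) p) ¬¬b))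
          (λ b → ≰⇒> λ j≤i → ¬b (ball-mono {j} {i} j≤i b))

      f : Fin (suc n) → ℕ
      f p = proj₁ (depth p)

      near : ∀ {p} j → f p ≤ j → ball j p
      near {p} j = to (proj₂ (depth p) j)

      height≤ : ∀ {p} j → ball j p → f p ≤ j
      height≤ {p} j = from (proj₂ (depth p) j)

      sorted = sortedBy f
      z = proj₁ sorted
      ys = proj₁ (proj₂ sorted)
      unique = proj₁ (proj₂ (proj₂ sorted))
      ascending = proj₁ (proj₂ (proj₂ (proj₂ sorted)))
      complete = proj₂ (proj₂ (proj₂ (proj₂ sorted)))

      away = evenAway 0≢q (path z ys) (path-distinct unique)
      c = proj₁ away

      f0 : ∀ {p} → f p ≡ 0 → Base p
      f0 e = near 0 (ℕₚ.≤-reflexive e)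

      -- The head of the sorted list has depth 0, because zero has, so it is a base point. All other
      -- points lie in the tail, and off the base points the parity correction is invisible.
      base⊎pred : ∀ p → Base p ⊎ (p ∈ ys × p ▹ c ≡ cycle z ys ⟨$⟩ʳ p)
      base⊎pred p with Base? p
      ... | yes base = inj₁ base
      ... | no ¬base with complete p
      ...   | there p∈ = inj₂ (p∈ , proj₂ away (¬base ∘ inj₁) (¬base ∘ inj₂))
      ...   | here refl = inj₁ (f0 (ℕₚ.n≤0⇒n≡0 (≤-trans (first (complete zero)) (height≤ {zero} 0 (inj₁ refl)))))
        where
        first : ∀ {y} → y ∈ z ∷ ys → f z ≤ f y
        first (here refl) = ≤-refl
        first (there y∈)  = All.lookup (AllPairs.head ascending) y∈

      ball-initial : ∀ i d → (∀ {p} → In d p ⇔ ball i p) → Initial c d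
      ball-initial i d coded p p∈ = Sum.map₂ (λ (p∈ys , e) → from coded (near i
          (subst (λ x → f x ≤ i) (sym e) (≤-trans (cycle-related unique ascending p∈ys) (height≤ i (to coded p∈))))))
        (base⊎pred p)

      -- The coded set is an initial segment of the sorted list. Points of equal depth are listed in
      -- an arbitrary order, hence the strict inequality.
      initial-below : ∀ d → Initial c d → ∀ {x y} → In d y → f x < f y → In d x
      initial-below d init {x} {y} y∈ fx<fy with AllPairs-compare
        (AllPairs.zip (ascending , closed⇒initial f (In d) (inj₁ ∘ f0) unique ascending
          (λ {p} p∈ys p∈ → [ (λ base → inj₁ (ℕₚ.n≤0⇒n≡0 (height≤ 0 base))) , (λ (_ , e) → Sum.map (ℕₚ.n≤0⇒n≡0 ∘ height≤ 0) (subst (In d) e) (init p p∈)) ]′ (base⊎pred p))))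
        (complete x) (complete y)
      ... | inj₁ refl = y∈
      ... | inj₂ (inj₁ (_ , back)) = back y∈
      ... | inj₂ (inj₂ (fy≤fx , _)) = contradiction fy≤fx (<⇒≱ fx<fy)

      layered : PtLayered
      layered = c , w , start , next , last
        where
        start : ∃ λ d → Initial c d × (∀ p → In d p → Base p)
        start = let (d , coded) = encodeBall 0 in d , ball-initial 0 d coded , λ p → to coded

        next : ∀ d → Initial c d → ∃ λ d′ → Initial c d′
             × (∀ p → N (In d) p → In d′ p) × (∀ p → In d′ p → N (N (In d)) p)
        next d init with all? (In? d)
        ... | yes all = let (d′ , coded) = encodeBall r in
          d′ , ball-initial r d′ coded , (λ p _ → from coded (total p)) , (λ p _ → N-infl (N-infl (all p)))
        ... | no ¬all with lastTrue (λ i → all? λ p → ball? i p →-dec In? d p) (λ p → inj₁) r (λ sub → ¬all λ p → sub p (total p))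
        -- For the set B coded by `d`, `ball i` is inside B and B inside `ball (suc i)`. Hence the
        -- ball of radius i + 2 lies between N B and N (N B).
        ...   | i , sub , ¬sub = let (d′ , coded) = encodeBall (2 ℕ.+ i) in
          d′ , ball-initial (2 ℕ.+ i) d′ coded
          , (λ p → from coded ∘ N-mono {In d} {ball (suc i)} above)
          , (λ p → N-mono {ball (suc i)} {N (In d)} (N-mono {ball i} {In d} (sub _)) ∘ to coded)
          where
          above : In d ⊆ ball (suc i)
          above {p} p∈ = decidable-stable (ball? (suc i) p) λ p∉ →
            ¬sub λ x x∈ → initial-below d init p∈ (≤-trans (s≤s (height≤ (suc i) x∈)) (≰⇒> (p∉ ∘ near (suc i))))

        -- Ball 0 is not everything by `unbased`, so there is a last incomplete ball. A point `w`
        -- outside it forces that ball into every initial set containing `w`.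
        farthest : ∃ λ i → ¬ (∀ p → ball i p) × ¬ ¬ (∀ p → ball (suc i) p)
        farthest = lastTrue (λ i → ¬? (all? (ball? i))) (λ all → proj₂ unbased (all _)) r (λ ¬all → ¬all total)

        i = proj₁ farthest
        outside = ¬∀⟶∃¬ (suc n) (ball i) (ball? i) (proj₁ (proj₂ farthest))
        w = proj₁ outside

        last : ∀ d → Initial c d → In d w → ∀ p → N (In d) p
        last d init w∈ p = N-mono {ball i} {In d}
          (λ x∈ → initial-below d init w∈ (≤-trans (s≤s (height≤ i x∈)) (≰⇒> (proj₂ outside ∘ near i))))
          (decidable-stable (all? (ball? (suc i))) (proj₂ (proj₂ farthest)) p)

    -- The balls stabilise at radius `r`. If the stable ball misses a point, it is itself the stuck
    -- set; otherwise every point has a depth.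
    stuck⊎layered : PtStuck ⊎ PtLayered
    stuck⊎layered with all? (ball? r)
    ... | yes total = inj₂ (Connected.layered total)
    ... | no ¬total = let (d , coded) = encodeBall r ; (p , p∉) = ¬∀⟶∃¬ _ _ (ball? r) ¬total in
      inj₁ (d , (p , p∉ ∘ to coded) , λ x → from coded ∘ proj₂ stable ∘ N-mono {In d} {ball r} (to coded))

-- The stabiliser of zero in Alternating (11 + m)

▹-injective : (x : A.Carrier n) {p r : Fin n} → p ▹ x ≡ r ▹ x → p ≡ r
▹-injective (π , _) e = trans (sym (inverseˡ π)) (trans (cong (π ⟨$⟩ˡ_) e) (inverseˡ π))

disjoint-commute : (x y : A.Carrier n) → (∀ p → p ▹ x ≡ p ⊎ p ▹ y ≡ p) → ∀ p → p ▹ x ▹ y ≡ p ▹ y ▹ x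
disjoint-commute x y disjoint p with disjoint p
... | inj₁ px≡p with disjoint (p ▹ y)
...   | inj₁ pyx≡py = trans (cong (_▹ y) px≡p) (sym pyx≡py)
...   | inj₂ pyy≡py = trans (cong (_▹ y) px≡p) (sym (trans (cong (_▹ x) py≡p) (trans px≡p (sym py≡p))))
  where py≡p = ▹-injective y pyy≡py
disjoint-commute x y disjoint p | inj₂ py≡p with disjoint (p ▹ x)
...   | inj₁ pxx≡px = trans (cong (_▹ y) px≡p) (trans py≡p (sym (trans (cong (_▹ x) py≡p) px≡p)))
  where px≡p = ▹-injective x pxx≡px
...   | inj₂ pxy≡px = trans pxy≡px (sym (cong (_▹ x) py≡p))

-- If they commuted, the involution u would act without fixed points on the
-- three-element orbit of p under s.
overlap-noncommute : (u s : A.Carrier n) (p : Fin n) →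
  (∀ r → r ▹ u ▹ u ≡ r) → p ▹ u ≢ p →
  p ▹ s ▹ s ▹ s ≡ p → (∀ {r} → r ▹ s ≢ r → r ≡ p ⊎ r ≡ p ▹ s ⊎ r ≡ p ▹ s ▹ s) → p ▹ s ≢ p →
  ¬ (∀ r → r ▹ u ▹ s ≡ r ▹ s ▹ u)
overlap-noncommute u s p uu pu≢p sss orbit ps≢p comm
  with orbit {p ▹ u} (λ pus≡pu → ps≢p (▹-injective u (trans (sym (comm p)) pus≡pu)))
... | inj₁ pu≡p         = pu≢p pu≡p
... | inj₂ (inj₁ pu≡ps) = ps≢p (sym (trans (sym sss) (cong (_▹ s) pss≡p)))
  where
  pss≡p : p ▹ s ▹ s ≡ p
  pss≡p = trans (cong (_▹ s) (sym pu≡ps)) (trans (comm p) (trans (cong (_▹ u) (sym pu≡ps)) (uu p)))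
... | inj₂ (inj₂ pu≡pss) = ps≢p (sym p≡ps)
  where
  psu≡p : p ▹ s ▹ u ≡ p
  psu≡p = trans (sym (comm p)) (trans (cong (_▹ s) pu≡pss) sss)
  pu≡ps : p ▹ u ≡ p ▹ s
  pu≡ps = trans (cong (_▹ u) (sym psu≡p)) (uu (p ▹ s))
  p≡ps : p ≡ p ▹ s
  p≡ps = ▹-injective s (trans (sym pu≡ps) pu≡pss)

module ThreeCycle (a b c : Fin n) (a≢b : a ≢ b) (a≢c : a ≢ c) (b≢c : b ≢ c) where
  s : A.Carrier n
  s = swaps a b a c a≢b a≢c

  a▹s : a ▹ s ≡ b
  a▹s = trans (cong (transpose a c ⟨$⟩ʳ_) (transpose-left a b)) (transpose-other (a≢b ∘ sym) b≢c)

  b▹s : b ▹ s ≡ c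
  b▹s = trans (cong (transpose a c ⟨$⟩ʳ_) (transpose-right a b)) (transpose-left a c)

  c▹s : c ▹ s ≡ a
  c▹s = trans (cong (transpose a c ⟨$⟩ʳ_) (transpose-other (a≢c ∘ sym) (b≢c ∘ sym))) (transpose-right a c)

  support : ∀ {p} → p ▹ s ≢ p → p ≡ a ⊎ p ≡ b ⊎ p ≡ c
  support {p} moved = go (p ≟ a) (p ≟ b) (p ≟ c)
    where
    go : Dec (p ≡ a) → Dec (p ≡ b) → Dec (p ≡ c) → p ≡ a ⊎ p ≡ b ⊎ p ≡ c
    go (yes p≡a) _ _ = inj₁ p≡a
    go (no _) (yes p≡b) _ = inj₂ (inj₁ p≡b)
    go (no _) (no _) (yes p≡c) = inj₂ (inj₂ p≡c)
    go (no p≢a) (no p≢b) (no p≢c) = contradiction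
      (trans (cong (transpose a c ⟨$⟩ʳ_) (transpose-other p≢a p≢b)) (transpose-other p≢a p≢c)) moved

  moves : a ▹ s ≢ a
  moves e = a≢b (sym (trans (sym a▹s) e))

  order3 : a ▹ s ▹ s ▹ s ≡ a
  order3 = trans (cong (λ p → p ▹ s ▹ s) a▹s) (trans (cong (_▹ s) b▹s) c▹s)

  orbit : ∀ {p} → p ▹ s ≢ p → p ≡ a ⊎ p ≡ a ▹ s ⊎ p ≡ a ▹ s ▹ s
  orbit moved = Sum.map₂ (Sum.map (λ e → trans e (sym a▹s))
    (λ e → trans e (sym (trans (cong (_▹ s) a▹s) b▹s)))) (support moved)

module DoubleSwap (v : Fin 4 → Fin n) (inj : ∀ {i j} → v i ≡ v j → i ≡ j) where
  private
    distinct : ∀ {i j} → i ≢ j → v i ≢ v j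
    distinct i≢j = i≢j ∘ inj
    a = v zero
    b = v (suc zero)
    c = v (suc (suc zero))
    d = v (suc (suc (suc zero)))

  t : A.Carrier n
  t = swaps a b c d (distinct λ ()) (distinct λ ())

  private
    T₂ = transpose c d ⟨$⟩ʳ_

    a▹t : a ▹ t ≡ b
    a▹t = trans (cong T₂ (transpose-left a b)) (transpose-other (distinct λ ()) (distinct λ ()))
    b▹t : b ▹ t ≡ a
    b▹t = trans (cong T₂ (transpose-right a b)) (transpose-other (distinct λ ()) (distinct λ ()))
    c▹t : c ▹ t ≡ d
    c▹t = trans (cong T₂ (transpose-other (distinct λ ()) (distinct λ ()))) (transpose-left c d)
    d▹t : d ▹ t ≡ c
    d▹t = trans (cong T₂ (transpose-other (distinct λ ()) (distinct λ ()))) (transpose-right c d)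

  support : ∀ {p} → p ▹ t ≢ p → ∃ λ i → p ≡ v i
  support {p} moved with any? (λ i → p ≟ v i)
  ... | yes hit = hit
  ... | no miss = contradiction (trans (cong T₂ (transpose-other (other _) (other _)))
                                       (transpose-other (other _) (other _))) moved
    where
    other : ∀ i → p ≢ v i
    other i e = miss (i , e)

  involutive : ∀ p → p ▹ t ▹ t ≡ p
  involutive p with p ▹ t ≟ p
  ... | yes fixed = trans (cong (_▹ t) fixed) fixed
  ... | no moved with support moved
  ...   | zero , refl                   = trans (cong (_▹ t) a▹t) b▹t
  ...   | suc zero , refl               = trans (cong (_▹ t) b▹t) a▹t
  ...   | suc (suc zero) , refl         = trans (cong (_▹ t) c▹t) d▹t
  ...   | suc (suc (suc zero)) , refl   = trans (cong (_▹ t) d▹t) c▹t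

  moves : a ▹ t ≢ a
  moves e = distinct {zero} {suc zero} (λ ()) (trans (sym e) a▹t)

-- Five 3-cycles through zero, otherwise disjoint, and two products of two
-- transpositions moving zero and otherwise disjoint; 11 = 1 + 5 · 2 points carry
-- the 3-cycles.  A conjugate of t i moves four points, one fewer than there are
-- 3-cycles, and a point other than zero is fixed by t zero or t (suc zero).
module Star (m : ℕ) where

  leg : Fin 5 → Fin 2 → Fin (11 + m)
  leg j e = suc (combine j e ↑ˡ m)

  leg-injective : ∀ {i j d e} → leg i d ≡ leg j e → i ≡ j × d ≡ e
  leg-injective {i} {j} {d} {e} eq =
    combine-injective i d j e (↑ˡ-injective m (combine i d) (combine j e) (suc-injective eq))

  -- The corners other than zero take 2 · 3 = 6 of the ten nonzero points of the star, whence
  -- `↑ˡ 4`. They may coincide with points of the legs.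
  corner : Fin 2 → Fin 4 → Fin (11 + m)
  corner i zero    = zero
  corner i (suc r) = suc ((combine i r ↑ˡ 4) ↑ˡ m)

  corner-suc-injective : ∀ {i j q r} → corner i (suc q) ≡ corner j (suc r) → i ≡ j × q ≡ r
  corner-suc-injective {i} {j} {q} {r} eq = combine-injective i q j r
    (↑ˡ-injective 4 (combine i q) (combine j r) (↑ˡ-injective m (combine i q ↑ˡ 4) (combine j r ↑ˡ 4) (suc-injective eq)))

  corner-injective : ∀ {i q r} → corner i q ≡ corner i r → q ≡ r
  corner-injective {q = zero}  {zero}  eq = refl
  corner-injective {i} {suc q} {suc r} eq = cong suc (proj₂ (corner-suc-injective {i} {i} {q} {r} eq))

  module S j = ThreeCycle zero (leg j zero) (leg j (suc zero)) (λ ()) (λ ())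
    (λ eq → contradiction (proj₂ (leg-injective {j} {j} {zero} {suc zero} eq)) λ ())
  module T i = DoubleSwap (corner i) (λ {q} {r} → corner-injective {i} {q} {r})

  s : Fin 5 → A.Carrier (11 + m)
  s = S.s

  t : Fin 2 → A.Carrier (11 + m)
  t = T.t

  s-overlap : ∀ {i j p} → i ≢ j → p ▹ s i ≢ p → p ▹ s j ≢ p → p ≡ zero
  s-overlap {i} {j} {p} i≢j mi mj with S.support i mi | S.support j mj
  ... | inj₁ e | _ = e
  ... | inj₂ _ | inj₁ e = e
  ... | inj₂ x | inj₂ y = let (d , p≡d) = onLeg {i} x ; (e , p≡e) = onLeg {j} y in
    contradiction (proj₁ (leg-injective {i} {j} {d} {e} (trans (sym p≡d) p≡e))) i≢j
    where
    onLeg : ∀ {i} → p ≡ leg i zero ⊎ p ≡ leg i (suc zero) → ∃ λ e → p ≡ leg i e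
    onLeg = [ (zero ,_) , (suc zero ,_) ]′

  t-overlap : ∀ {p} → p ▹ t zero ≢ p → p ▹ t (suc zero) ≢ p → p ≡ zero
  t-overlap m₀ m₁ with T.support zero m₀ | T.support (suc zero) m₁
  ... | zero , e | _ = e
  ... | suc _ , _ | zero , e = e
  ... | suc q , e | suc r , e′ =
    contradiction (proj₁ (corner-suc-injective {zero} {suc zero} {q} {r} (trans (sym e) e′))) λ ()

  open A (11 + m) using (_∙_; _⁻¹)

  NonCommuting : A.Carrier (11 + m) → Set
  NonCommuting z = ∀ i j → ¬ (∀ p → p ▹ (z ⁻¹ ∙ t i ∙ z) ▹ s j ≡ p ▹ s j ▹ (z ⁻¹ ∙ t i ∙ z))

  fixes⇒NonCommuting : ∀ z → zero ▹ z ≡ zero → NonCommuting z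
  fixes⇒NonCommuting z@(π , _) z0 i j = overlap-noncommute (z ⁻¹ ∙ t i ∙ z) (s j) zero uu moved
    (S.order3 j) (S.orbit j) (S.moves j)
    where
    uu : ∀ p → p ▹ (z ⁻¹ ∙ t i ∙ z) ▹ (z ⁻¹ ∙ t i ∙ z) ≡ p
    uu p = trans (cong (λ q → q ▹ t i ▹ z) (inverseˡ π)) (trans (cong (_▹ z) (T.involutive i (p ▹ z ⁻¹))) (inverseʳ π))
    moved : zero ▹ (z ⁻¹ ∙ t i ∙ z) ≢ zero
    moved e = T.moves i (▹-injective z (trans (cong (λ q → q ▹ t i ▹ z) (sym z⁻¹0)) (trans e (sym z0))))
      where
      z⁻¹0 : zero ▹ z ⁻¹ ≡ zero
      z⁻¹0 = trans (cong (_▹ z ⁻¹) (sym z0)) (inverseˡ π)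

  -- A conjugate of t i that fixes zero moves only four points, so it cannot
  -- meet all five legs of the star.
  NonCommuting⇒fixes : ∀ z → NonCommuting z → zero ▹ z ≡ zero
  NonCommuting⇒fixes z@(π , _) nc = decidable-stable (zero ▹ z ≟ zero) λ z0≢0 →
    -- The point that z sends to zero is not zero, so one of the two `t i` fixes it, and the
    -- conjugate of that one fixes zero.
    let (i , fixed) = avoid (zero ▹ z ⁻¹) (λ e → z0≢0 (trans (cong (_▹ z) (sym e)) (inverseʳ π))) in
    clash i (trans (cong (_▹ z) fixed) (inverseʳ π))
    where
    avoid : ∀ p → p ≢ zero → ∃ λ i → p ▹ t i ≡ p
    avoid p p≢0 with p ▹ t zero ≟ p | p ▹ t (suc zero) ≟ p
    ... | yes e | _     = zero , e
    ... | no _  | yes e = suc zero , e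
    ... | no m₀ | no m₁ = contradiction (t-overlap m₀ m₁) p≢0

    clash : ∀ i → zero ▹ (z ⁻¹ ∙ t i ∙ z) ≢ zero
    clash i u0 = collide (pigeonhole (n<1+n 4) corner#)
      where
      u = z ⁻¹ ∙ t i ∙ z
      meet : ∀ j → ∃ λ p → p ▹ u ≢ p × p ▹ s j ≢ p
      meet j with any? (λ p → ¬? (p ▹ u ≟ p) ×-dec ¬? (p ▹ s j ≟ p))
      ... | yes hit = hit
      ... | no miss = contradiction (disjoint-commute u (s j) λ p → split p) (nc i j)
        where
        split : ∀ p → p ▹ u ≡ p ⊎ p ▹ s j ≡ p
        split p with p ▹ u ≟ p | p ▹ s j ≟ p
        ... | yes e | _ = inj₁ e
        ... | no _ | yes e = inj₂ e
        ... | no m | no m′ = contradiction (p , m , m′) miss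
      y : Fin 5 → Fin (11 + m)
      y j = proj₁ (meet j)
      preimage : ∀ j → ∃ λ r → y j ▹ z ⁻¹ ≡ corner i r
      preimage j = T.support i λ e → proj₁ (proj₂ (meet j)) (trans (cong (_▹ z) e) (inverseʳ π))
      corner# : Fin 5 → Fin 4
      corner# j = proj₁ (preimage j)
      collide : ¬ ∃₂ λ j j′ → j Fin.< j′ × corner# j ≡ corner# j′
      collide (j , j′ , j<j′ , e) = proj₁ (proj₂ (meet j)) (subst (λ p → p ▹ u ≡ p) (sym yj≡0) u0)
        where
        same : y j ≡ y j′
        same = ▹-injective (z ⁻¹) (trans (proj₂ (preimage j)) (trans (cong (corner i) e) (sym (proj₂ (preimage j′)))))
        yj≡0 : y j ≡ zero
        yj≡0 = s-overlap (<⇒≢ j<j′) (proj₂ (proj₂ (meet j)))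
          (subst (λ p → p ▹ s j′ ≢ p) (sym same) (proj₂ (proj₂ (meet j′))))

-- The sentence holds in large alternating groups

module Layering (m : ℕ) {k} (ρ : Vec (A.Carrier (11 + m)) (7 + k))
                (s≡ : ∀ j → Vec.lookup ρ ((j ↑ˡ 2) ↑ˡ k) ≡ Star.s m j)
                (t≡ : ∀ i → Vec.lookup ρ ((5 ↑ʳ i) ↑ˡ k) ≡ Star.t m i) where
  open Star m
  open A (11 + m) using (_∙_; _⁻¹; ε)
  open Sem (Alternating (11 + m)) ρ hiding (H⇔)

  private
    s₀ = Vec.lookup ρ zero

    Commuting : (z b a : A.Carrier (11 + m)) → Set
    Commuting z b a = ∀ p → p ▹ (z ⁻¹ ∙ b ∙ z) ▹ a ≡ p ▹ a ▹ (z ⁻¹ ∙ b ∙ z)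

    commuting≡ : ∀ z i j → Commuting z (Vec.lookup ρ ((5 ↑ʳ i) ↑ˡ k)) (Vec.lookup ρ ((j ↑ˡ 2) ↑ˡ k))
                         ≡ Commuting z (t i) (s j)
    commuting≡ z i j = cong₂ (Commuting z) (t≡ i) (s≡ j)

  H⇔ : ∀ z → H z ⇔ zero ▹ z ≡ zero
  H⇔ z = mk⇔
    (λ h → NonCommuting⇒fixes z λ i j comm →
      to (Sem.H⇔ (Alternating (11 + m)) ρ z) h i j (subst id (sym (commuting≡ z i j)) comm))
    (λ z0 → from (Sem.H⇔ (Alternating (11 + m)) ρ z) λ i j comm →
      fixes⇒NonCommuting z z0 i j (subst id (commuting≡ z i j) comm))

  q : Fin (11 + m)
  q = zero ▹ s₀

  Nbr : Pred (Fin (11 + m)) 0ℓ → Pred (Fin (11 + m)) 0ℓ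
  Nbr B p = B p ⊎ ∃ λ j → B (p ▹ g j ⁻¹) ⊎ B (p ▹ g j)

  Nbr-mono : ∀ {B C} → B ⊆ C → Nbr B ⊆ Nbr C
  Nbr-mono B⊆C = Sum.map B⊆C λ (j , b) → j , Sum.map B⊆C B⊆C b

  open Points {10 + m} q Nbr

  points : PtStuck ⊎ PtLayered
  points = stuck⊎layered
    (λ B? p → B? p ⊎-dec any? λ j → B? (p ▹ g j ⁻¹) ⊎-dec B? (p ▹ g j))
    (λ {B} {C} → Nbr-mono {B} {C}) inj₁ (λ e → S.moves zero (trans (cong (zero ▹_) (sym (s≡ zero))) (sym e)))
    -- The base points are zero and `leg zero zero`, its image under `s₀`, so a point of another leg
    -- is not a base point.
    (leg (suc zero) zero , λ
      { (inj₁ ())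
      ; (inj₂ e) → contradiction (proj₁ (leg-injective {suc zero} {zero} {zero} {zero} (trans e (trans (cong (zero ▹_) (s≡ zero)) (S.a▹s zero))))) λ () })

  transitive : (p : Fin (11 + m)) → ∃ λ (x : A.Carrier (11 + m)) → zero ▹ x ≡ p
  transitive zero = ε , refl
  -- A transposition would be odd, so a third point completes a 3-cycle; it has to avoid `suc p`,
  -- hence the two cases.
  transitive (suc p) with p ≟ zero
  ... | yes refl = swaps zero (suc p) zero (suc (suc zero)) (λ ()) (λ ()) ,
    ThreeCycle.a▹s zero (suc zero) (suc (suc zero)) (λ ()) (λ ()) (λ ())
  ... | no p≢0 = swaps zero (suc p) zero (suc zero) (λ ()) (λ ()) ,
    ThreeCycle.a▹s zero (suc p) (suc zero) (λ ()) (λ ()) (λ { refl → p≢0 refl })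

  atPoint : {P : Fin (11 + m) → Set} → (∀ x → P (zero ▹ x)) → ∀ p → P p
  atPoint {P} all p = let (x , e) = transitive p in subst P e (all x)

  ∙⁻¹-fixes⇔ : ∀ x y → zero ▹ (x ∙ y ⁻¹) ≡ zero ⇔ zero ▹ x ≡ zero ▹ y
  ∙⁻¹-fixes⇔ x y = mk⇔
    (λ e → trans (sym (inverseʳ (proj₁ y))) (cong (_▹ y) e))
    (λ e → trans (cong (_▹ y ⁻¹) e) (inverseˡ (proj₁ y)))

  H∙⁻¹⇔ : ∀ x y → H (x ∙ y ⁻¹) ⇔ zero ▹ x ≡ zero ▹ y
  H∙⁻¹⇔ x y = mk⇔ (to (∙⁻¹-fixes⇔ x y) ∘ to (H⇔ (x ∙ y ⁻¹))) (from (H⇔ (x ∙ y ⁻¹)) ∘ from (∙⁻¹-fixes⇔ x y))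

  Q⇔ : ∀ x → Q x ⇔ Base (zero ▹ x)
  Q⇔ x = mk⇔ (Sum.map (to (H⇔ x)) (to (H∙⁻¹⇔ x s₀)))
             (Sum.map (from (H⇔ x)) (from (H∙⁻¹⇔ x s₀)))

  M⇔ : ∀ d x → M d x ⇔ In d (zero ▹ x)
  M⇔ d x = mk⇔ (Sum.map (to (Q⇔ x)) (to (H∙⁻¹⇔ (x ∙ d) x)))
               (Sum.map (from (Q⇔ x)) (from (H∙⁻¹⇔ (x ∙ d) x)))

  N⇒Nbr : ∀ d x → N (M d) x → Nbr (In d) (zero ▹ x)
  N⇒Nbr d x = N-map {M d} {λ x → In d (zero ▹ x)} (λ {x} → to (M⇔ d x)) {x}

  Nbr⇒N : ∀ d x → Nbr (In d) (zero ▹ x) → N (M d) x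
  Nbr⇒N d x = N-map {λ x → In d (zero ▹ x)} {M d} (λ {x} → from (M⇔ d x)) {x}

  Θ⇔ : ∀ c d → Θ c d ⇔ Initial c d
  Θ⇔ c d = mk⇔
    (λ θ → atPoint λ x m → Sum.map (to (Q⇔ x)) (to (M⇔ d (x ∙ c))) (θ x (from (M⇔ d x) m)))
    (λ init x m → Sum.map (from (Q⇔ x)) (from (M⇔ d (x ∙ c))) (init (zero ▹ x) (to (M⇔ d x) m)))

  stuck : PtStuck → Stuck
  stuck (d , (p , p∉) , closed) =
    let (x , e) = transitive p in
    d , (x , λ m → contradiction (subst (In d) e (to (M⇔ d x) m)) p∉)
      , λ x → from (M⇔ d x) ∘ closed (zero ▹ x) ∘ N⇒Nbr d x

  layered : PtLayered → Layered
  layered (c , p , (d₀ , init₀ , base) , next , last) =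
    let (w , e) = transitive p in
      c , w
    , (d₀ , from (Θ⇔ c d₀) init₀ , λ x → from (Q⇔ x) ∘ base (zero ▹ x) ∘ to (M⇔ d₀ x))
    , (λ d θ → let (d′ , init′ , sub , sup) = next d (to (Θ⇔ c d) θ) in
         d′ , from (Θ⇔ c d′) init′ , (λ x → from (M⇔ d′ x) ∘ sub (zero ▹ x) ∘ N⇒Nbr d x)
            , (λ x → N-map {λ x → Nbr (In d) (zero ▹ x)} {N (M d)} (λ {x} → Nbr⇒N d x) {x}
                   ∘ sup (zero ▹ x) ∘ to (M⇔ d′ x)))
    , (λ d θ m x → Nbr⇒N d x (last d (to (Θ⇔ c d) θ) (subst (In d) e (to (M⇔ d w) m)) (zero ▹ x)))

  closed : Closed
  closed x y hx hy = from (H⇔ (x ∙ y)) (trans (cong (_▹ y) (to (H⇔ x) hx)) (to (H⇔ y) hy))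

  faithful : Faithful
  faithful x x′ agree = lift (atPoint λ y → let (y′ , h , h′) = agree y in
    trans (to (H∙⁻¹⇔ (y ∙ x) y′) h) (sym (to (H∙⁻¹⇔ (y ∙ x′) y′) h′)))

  satisfied : Sat (Alternating (11 + m)) (χ k) ρ
  satisfied = from χ⇔ (from (H⇔ ε) refl , closed , faithful , Sum.map stuck layered points)

star-satisfies : (m k : ℕ) (σ : Vec (A.Carrier (11 + m)) 7) (γ : Vec (A.Carrier (11 + m)) k) →
  (∀ j → Vec.lookup (σ Vec.++ γ) ((j ↑ˡ 2) ↑ˡ k) ≡ Star.s m j) →
  (∀ i → Vec.lookup (σ Vec.++ γ) ((5 ↑ʳ i) ↑ˡ k) ≡ Star.t m i) →
  Sat (Alternating (11 + m)) (basedᶠ k) γ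
star-satisfies m k σ γ s≡ t≡ = from (Sat-based (Alternating (11 + m)) k γ)
  (σ , Layering.satisfied m {k} (σ Vec.++ γ) s≡ t≡)

Alternating⊨layering : ∀ k m → Alternating (11 + m) ⊨ layering k
Alternating⊨layering k m = from (Sat-close∀ (Alternating (11 + m)) k (basedᶠ k)) λ γ →
  star-satisfies m k σ γ (s≡ γ) (t≡ γ)
  where
  open Star m

  σ : Vec (A.Carrier (11 + m)) 7
  σ = Vec.tabulate s Vec.++ Vec.tabulate t

  s≡ : ∀ (γ : Vec (A.Carrier (11 + m)) k) j → Vec.lookup (σ Vec.++ γ) ((j ↑ˡ 2) ↑ˡ k) ≡ s j
  s≡ γ j = trans (lookup-++ˡ σ γ (j ↑ˡ 2))
    (trans (lookup-++ˡ (Vec.tabulate s) (Vec.tabulate t) j) (lookup∘tabulate s j))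

  t≡ : ∀ (γ : Vec (A.Carrier (11 + m)) k) i → Vec.lookup (σ Vec.++ γ) ((5 ↑ʳ i) ↑ˡ k) ≡ t i
  t≡ γ i = trans (lookup-++ˡ σ γ (5 ↑ʳ i))
    (trans (lookup-++ʳ (Vec.tabulate s) (Vec.tabulate t) i) (lookup∘tabulate t i))

-- Transfer to G

coveredᶠ : (K : ℕ) → Formula K
coveredᶠ K = ∀ᶠ (⋁ λ i → var zero ≐ var (suc i))

-- This bounds the order of a group by K and serves the case of bounded degrees, where the star does
-- not fit.
exhausted : ℕ → Sentence
exhausted K = close∃ K (coveredᶠ K)

module _ (G : Group ℓ₁ ℓ₂) where
  open Group G using (Carrier; _≈_) renaming (trans to ≈-trans; sym to ≈-sym; reflexive to ≈-reflexive)

  Sat-covered : ∀ {K} (σ : Vec Carrier K) → Sat G (coveredᶠ K) σ ⇔ (∀ x → ∃ λ i → x ≈ Vec.lookup σ i)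
  Sat-covered {K} σ = mk⇔
    (λ s x → let (i , lift e) = to (Sat-⋁ G (equation {K}) {x ∷ σ}) (s x) in i , e)
    (λ cover x → let (i , e) = cover x in from (Sat-⋁ G (equation {K}) {x ∷ σ}) (i , lift e))
    where
    equation : ∀ {K} → Fin K → Formula (suc K)
    equation i = var zero ≐ var (suc i)

  enumerated⇒exhausted : ((xs , _) : Enumerated G) → G ⊨ exhausted (length xs)
  enumerated⇒exhausted (xs , cover) = from (Sat-close∃ G (length xs) (coveredᶠ (length xs)))
    (Vec.tabulate (List.lookup xs) , from (Sat-covered (Vec.tabulate (List.lookup xs))) λ x →
      let i = Any.index (cover x) in
      i , ≈-trans (lookup-index (cover x)) (≈-reflexive (sym (lookup∘tabulate (List.lookup xs) i))))

  exhausted⇒finite : ∀ K → G ⊨ exhausted K → ¬ ¬ Finite G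
  exhausted⇒finite K sat =
    let (σ , s) = to (Sat-close∃ G K (coveredᶠ K)) sat
        cover = to (Sat-covered σ) s
    in ¬¬finite G (λ x → proj₁ (cover x)) λ {x} {y} e →
      ≈-trans (proj₂ (cover x)) (≈-trans (≈-reflexive (cong (Vec.lookup σ) e)) (≈-sym (proj₂ (cover y))))

⟨⟩-cong : (G : Group ℓ₁ ℓ₂) {f g : Fin k → Group.Carrier G} → (∀ j → f j ≡ g j) →
          ∀ {x} → ⟨_⟩ G f x → ⟨_⟩ G g x
⟨⟩-cong G f≗g (gen j)    = subst (⟨_⟩ G _) (sym (f≗g j)) (gen j)
⟨⟩-cong G f≗g unit       = unit
⟨⟩-cong G f≗g (mul p q)  = mul (⟨⟩-cong G f≗g p) (⟨⟩-cong G f≗g q)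
⟨⟩-cong G f≗g (inv p)    = inv (⟨⟩-cong G f≗g p)
⟨⟩-cong G f≗g (resp e p) = resp e (⟨⟩-cong G f≗g p)

layering⇒finite : (G : Group ℓ₁ ℓ₂) ((k , _) : FinitelyGenerated G) → G ⊨ layering k → ¬ ¬ Finite G
layering⇒finite G (k , g , generated) sat =
  let (σ , s) = to (Sat-based G k (Vec.tabulate g)) (to (Sat-close∀ G k (basedᶠ k)) sat (Vec.tabulate g)) in
  Generated.χ⇒finite G (σ Vec.++ Vec.tabulate g)
    (λ x → ⟨⟩-cong G (λ j → sym (trans (lookup-++ʳ σ (Vec.tabulate g) j) (lookup∘tabulate g j))) (generated x)) s

module _ {I : Set ℓ₁} (𝓤 : Ultrafilter I 0ℓ ℓ₂) where
  open Ultrafilter 𝓤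

  -- The top value is either attained on a large set or can be removed from the bound; the bound
  -- cannot reach 0, because the empty set is not large.
  bounded⇒constant : (n : I → ℕ) (N : ℕ) → Large (λ j → n j < N) → ∃ λ r → Large (λ j → n j ≡ r)
  bounded⇒constant n zero    small = contradiction (superset (λ ()) small) proper
  bounded⇒constant n (suc N) small with ultra (λ j → n j < N) (λ j → n j ℕₚ.<? N)
  ... | inj₁ smaller = bounded⇒constant n N smaller
  ... | inj₂ larger  = N , superset
    (λ (n<1+N , n≮N) → ℕₚ.≤-antisym (ℕₚ.m<1+n⇒m≤n n<1+N) (ℕₚ.≮⇒≥ n≮N)) (meet small larger)

theorem2p1 : ∀ {c ℓ i u : Level} (G : Group c ℓ) → Infinite G → FinitelyGenerated G →
    (I : Set i) (𝓤 : Ultrafilter I 0ℓ u) (n : I → ℕ) →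
    ¬ ElementarilyEquivalent G (Ultraproduct 𝓤 (λ j → Alternating (n j)))
theorem2p1 G infinite fg@(k , _) I 𝓤 n G≡ = decide (ultra (λ j → 11 ≤ n j) (λ j → 11 ℕₚ.≤? n j))
  where
  open Ultrafilter 𝓤

  transfer : ∀ φ → Large (λ j → Alternating (n j) ⊨ φ) → G ⊨ φ
  transfer φ = from (G≡ φ) ∘ Łoś⇐ 𝓤 (Alternating ∘ n) (Alternating-enumerated ∘ n) (λ {j} → _≟ᴬ_ {n j}) φ []

  decide : Large (λ j → 11 ≤ n j) ⊎ Large (λ j → ¬ 11 ≤ n j) → ⊥
  decide (inj₁ large) = layering⇒finite G fg (transfer (layering k) (superset
    (λ {j} 11≤n → subst (λ n → Alternating n ⊨ layering k) (m+[n∸m]≡n 11≤n)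
                        (Alternating⊨layering k (n j ℕ.∸ 11))) large)) infinite
  -- On a large set the factors are one and the same alternating group, and the bound on its order
  -- passes to `G`.
  decide (inj₂ small) =
    let (r , constant) = bounded⇒constant 𝓤 n 11 (superset ≰⇒> small)
        enumeration = Alternating-enumerated r
        K = length (proj₁ enumeration)
    in exhausted⇒finite G K (transfer (exhausted K) (superset
         (λ n≡r → subst (λ n → Alternating n ⊨ exhausted K) (sym n≡r)
                        (enumerated⇒exhausted (Alternating r) enumeration)) constant)) infinite
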